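{- There exist $c>0$ and $n_0\ge 2$ for which the following holds. For all integers $n\ge n_0$ and $1\le d\le cn/\log^2 n$, every $n$-vertex graph $G$ with minimum degree $\delta(G)\ge d$ has pseudoachromatic number $\psi_s(G)\ge d+1$.
   Context: Graphs are finite and simple; $\log$ is the natural logarithm and $\log^2 n=(\log n)^2$. A pseudocomplete colouring of a graph is a colouring of its vertices, not necessarily proper, such that each pair of distinct colours appears together on at least one edge; equivalently, it is a partition of the vertex set (into nonempty parts) in which every two distinct parts are connected by at least one edge. The pseudoachromatic number $\psi_s(G)$ is the maximum number of colours in a pseudocomplete colouring of $G$. -}

module Defs where

open import Level using (0ℓ)
open import Data.Nat.Base as ℕ using (ℕ; zero; suc; z≤n; s≤s; _!)
open import Data.Nat.Properties as ℕ using (_!≢0)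
open import Data.Integer.Base using (+_; 1ℤ)
open import Data.Rational.Base as ℚ using (ℚ; 0ℚ)
open import Data.Fin.Base using (Fin; zero; suc; finToFun; funToFin)
open import Data.Fin.Properties as Fin using (any?; all?; finToFun-funToFin)
open import Data.List.Base using (map; filter; length; allFin; upTo)
open import Data.List.Extrema.Nat using (min; max; xs≤max; argmax-sel)
open import Data.List.Membership.Propositional.Properties
  using (∈-filter⁺; ∈-filter⁻; ∈-upTo⁺)
import Data.List.Relation.Unary.All as All
open import Data.Product.Base using (∃; ∃₂; _×_; _,_; proj₁; proj₂)
open import Data.Sum.Base using (inj₁; inj₂)
open import Function.Base using (id; _∘_; const)
open import Function.Definitions using (StrictlySurjective)
open import Relation.Binary.Core using (Rel)
open import Relation.Binary.Definitions using (Decidable; Symmetric; Irreflexive)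
open import Relation.Binary.PropositionalEquality
  using (_≡_; _≢_; _≗_; refl; sym; trans; cong; subst)
open import Relation.Nullary.Decidable using (Dec; map′; _×-dec_; _→-dec_; ¬?)
open import Relation.Nullary.Negation using (contradiction)

open import Algebra.Definitions.RawSemiring ℚ.+-*-rawSemiring using (_^_)

record Graph (n : ℕ) : Set₁ where
  field
    _~_     : Rel (Fin n) 0ℓ
    _~?_    : Decidable _~_
    ~-sym   : Symmetric _~_
    ~-irrefl : Irreflexive _≡_ _~_

  degree : Fin n → ℕ
  degree v = length (filter (v ~?_) (allFin n))

  -- Every degree is below n, so the default value n is only taken when n = 0.
  δ : ℕ
  δ = min n (map degree (allFin n))

-- The colours are exactly Fin k: surjectivity says that each of the k colour
-- classes is nonempty, which the condition on pairs does not force for k = 1.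
record IsPseudocomplete {n} (G : Graph n) {k} (f : Fin n → Fin k) : Set where
  open Graph G
  field
    surjective : StrictlySurjective _≡_ f
    connected  : ∀ i j → i ≢ j → ∃₂ λ u v → u ~ v × f u ≡ i × f v ≡ j

PseudocompleteColouring : ∀ {n} → Graph n → ℕ → Set
PseudocompleteColouring {n} G k = ∃ λ (f : Fin n → Fin k) → IsPseudocomplete G f

module _ {n} (G : Graph n) where
  open Graph G
  open IsPseudocomplete

  private
    isPseudocomplete? : ∀ {k} (f : Fin n → Fin k) → Dec (IsPseudocomplete G f)
    isPseudocomplete? f =
      map′ (λ (s , c) → record { surjective = s ; connected = c })
           (λ p → surjective p , connected p)
           (all? (λ i → any? λ u → f u Fin.≟ i)
            ×-dec
            all? (λ i → all? λ j → ¬? (i Fin.≟ j) →-dec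
              any? λ u → any? λ v →
                (u ~? v) ×-dec (f u Fin.≟ i) ×-dec (f v Fin.≟ j)))

    resp-≗ : ∀ {k} {f g : Fin n → Fin k} → f ≗ g →
             IsPseudocomplete G f → IsPseudocomplete G g
    resp-≗ f≗g p .surjective i =
      let u , eq = surjective p i in u , trans (sym (f≗g u)) eq
    resp-≗ f≗g p .connected i j i≢j =
      let u , v , e , eqᵢ , eqⱼ = connected p i j i≢j in
      u , v , e , trans (sym (f≗g u)) eqᵢ , trans (sym (f≗g v)) eqⱼ

  pseudocompleteColouring? : ∀ k → Dec (PseudocompleteColouring G k)
  pseudocompleteColouring? k =
    map′ (λ (c , p) → finToFun c , p)
         (λ (f , p) → funToFin f , resp-≗ (sym ∘ finToFun-funToFin f) p)
         (any? λ (c : Fin (k ℕ.^ n)) → isPseudocomplete? (finToFun c))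

  -- A surjective colouring has at most n colours, so searching up to n suffices;
  -- ψₛ-attained and ψₛ-maximum confirm that this is the maximum over all k.
  ψₛ : ℕ
  ψₛ = max 0 (filter pseudocompleteColouring? (upTo (suc n)))

  private
    colours≤n : ∀ {k} → PseudocompleteColouring G k → k ℕ.≤ n
    colours≤n (f , p) = Fin.injective⇒≤ {f = proj₁ ∘ surjective p} λ {i} {j} eq →
      trans (sym (proj₂ (surjective p i)))
            (trans (cong f eq) (proj₂ (surjective p j)))

  ψₛ-maximum : ∀ {k} → PseudocompleteColouring G k → k ℕ.≤ ψₛ
  ψₛ-maximum c = All.lookup (xs≤max 0 _)
    (∈-filter⁺ pseudocompleteColouring? (∈-upTo⁺ (s≤s (colours≤n c))) c)

trivialColouring : ∀ {n} (G : Graph n) → ∃ (PseudocompleteColouring G)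
trivialColouring {zero}  G = 0 , id , record { surjective = λ () ; connected = λ () }
trivialColouring {suc n} G = 1 , const zero , record
  { surjective = λ { zero → zero , refl }
  ; connected  = λ { zero zero 0≢0 → contradiction refl 0≢0 }
  }

ψₛ-attained : ∀ {n} (G : Graph n) → PseudocompleteColouring G (ψₛ G)
ψₛ-attained {n} G
  with argmax-sel id 0 (filter (pseudocompleteColouring? G) (upTo (suc n)))
... | inj₂ ψₛ∈ = proj₂ (∈-filter⁻ (pseudocompleteColouring? G) {xs = upTo (suc n)} ψₛ∈)
... | inj₁ ψₛ≡0 with trivialColouring G
...   | k , c = subst (PseudocompleteColouring G) k≡ψₛ c
  where
  k≡0 : k ≡ 0
  k≡0 = ℕ.n≤0⇒n≡0 (subst (k ℕ.≤_) ψₛ≡0 (ψₛ-maximum G c))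
  k≡ψₛ : k ≡ ψₛ G
  k≡ψₛ = trans k≡0 (sym ψₛ≡0)

fromℕ : ℕ → ℚ
fromℕ n = + n ℚ./ 1

-- ∑_{k < K} qᵏ / k!
expSum : ℚ → ℕ → ℚ
expSum q zero    = 0ℚ
expSum q (suc K) = expSum q K ℚ.+ (q ^ K) ℚ.* (1ℤ ℚ./ (K !)) {{K !≢0}}

-- For q ≥ 0 the partial sums increase to exp q, so this says exp q ≤ n, that is,
-- q ≤ log n.  The real number log n (n ≥ 1) is thus given by the nonnegative
-- rationals below it.
record _≤log_ (q : ℚ) (n : ℕ) : Set where
  field
    nonNegative : 0ℚ ℚ.≤ q
    exp≤        : ∀ K → expSum q K ℚ.≤ fromℕ n

-- d ≤ c m / log² n for n ≥ 2, with the positive denominator cleared: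
-- log² n is the supremum of q² over the rationals 0 ≤ q ≤ log n, so
-- d log² n ≤ c m holds iff d q² ≤ c m for all such q.
_≤_·_/log²_ : ℕ → ℚ → ℕ → ℕ → Set
d ≤ c · m /log² n = ∀ q → q ≤log n → fromℕ d ℚ.* q ^ 2 ℚ.≤ c ℚ.* fromℕ m

{-# OPTIONS --safe #-}

-- Write k = d + 1 and let e be a multiple of log n with k² < 2 ^ e, so that
-- d e² is a small fraction of n.  Give every colour i a set Aᵢ of vertices in
-- advance and colour the remaining vertices at random.  If Aᵢ has x e uncoloured
-- neighbours and the colour j has probability at least 1 / x, then j is missed
-- with probability at most 2 ^ (- e), and there are fewer than 2 ^ e pairs.
--
-- Call a vertex high if its degree is at least 35 e k.  High vertices are their
-- own Aᵢ, with x = 2 k, and d of them suffice.  If there are only h < d, then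
-- m = k - h low colours remain, which have to meet only one another in the graph
-- on the low vertices; this graph has minimum degree at least d′ = m - 1.  Giving
-- each low colour a probability of at least 1 / (2 m) still leaves 1 / (2 k) for
-- the high ones.  In a cut of the low graph with at least half of its edges, grow
-- each low Aᵢ on one side by vertices with more than d′ / 16 new neighbours on
-- the other side.  32 e such vertices give 2 m e neighbours, and they exist
-- because the used vertices and the neighbours reached so far, O(e m) in number
-- and of degree O(e k), meet only a small part of the Ω(n d′) edges.
module Submission where

open import Defs
open import Data.Bool.Base using (Bool; true; false; not; _∧_; _∨_; if_then_else_)
import Data.Bool.Properties as Bool
open import Data.Fin.Base as Fin
  using (Fin; zero; suc; toℕ; _↑ˡ_; _↑ʳ_; splitAt; combine; remQuot; punchIn)
open import Data.Fin.Properties as Fin using (any?)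
open import Data.Integer.Base as ℤ using (1ℤ)
import Data.Integer.Properties as ℤ
open import Data.List.Base using (length; filter; tabulate)
open import Data.List.Extrema.Nat using (min≤xs)
open import Data.List.Membership.Propositional.Properties using (∈-map⁺; ∈-allFin)
import Data.List.Relation.Unary.All as All
open import Data.Maybe.Base as Maybe using (Maybe; just; nothing; is-just; fromMaybe; maybe′)
open import Data.Nat.Base
  using (ℕ; zero; suc; _+_; _*_; _^_; _/_; _!; _≤_; _<_; z≤n; s≤s; NonZero; >-nonZero; >-nonZero⁻¹)
open import Data.Nat.DivMod using (m/n*n≤m; m≡m%n+[m/n]*n; m%n<n)
open import Data.Nat.Properties
open import Data.Nat.Tactic.RingSolver using (solve-∀)
open import Data.Product.Base using (∃; ∃₂; ∃-syntax; _×_; _,_; proj₁; proj₂)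
open import Data.Rational.Base as ℚ using (0ℚ; 1ℚ; toℚᵘ)
import Data.Rational.Properties as ℚ
open import Data.Rational.Solver using (module +-*-Solver)
open import Data.Rational.Unnormalised.Base as ℚᵘ using (mkℚᵘ; *≡*; *≤*)
import Data.Rational.Unnormalised.Properties as ℚᵘ
open import Data.Sum.Base using (_⊎_; inj₁; inj₂; [_,_]′)
open import Function.Base using (_∘_; id; const)
open import Relation.Binary.Definitions using (tri<; tri≈; tri>)
open import Relation.Binary.PropositionalEquality hiding ([_])
open import Relation.Nullary using (Dec; yes; no; does; contradiction)
open import Relation.Nullary.Decidable using (_×-dec_; dec-true; dec-false)
open import Algebra.Definitions.RawSemiring ℚ.+-*-rawSemiring
  using () renaming (_^_ to _^ℚ_)
open import Algebra.Properties.CommutativeMonoid.Sum *-1-commutativeMonoid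
  using () renaming (sum to product)
open import Algebra.Properties.Semiring.Sum +-*-semiring
  using (sum; sum-cong-≗; ∑-distrib-+; ∑-comm; *-distribˡ-sum; *-distribʳ-sum)

-- Colourings that hit prescribed sets

𝟙 : Bool → ℕ
𝟙 true  = 1
𝟙 false = 0

count : ∀ {n} → (Fin n → Bool) → ℕ
count p = sum (𝟙 ∘ p)

sum-mono : ∀ {n} {f g : Fin n → ℕ} → (∀ i → f i ≤ g i) → sum f ≤ sum g
sum-mono {zero}  f≤g = z≤n
sum-mono {suc n} f≤g = +-mono-≤ (f≤g zero) (sum-mono (f≤g ∘ suc))

sum-const : ∀ n c → sum {n} (λ _ → c) ≡ n * c
sum-const zero    c = refl
sum-const (suc n) c = cong (c +_) (sum-const n c)

sum-≤ : ∀ {n c} {f : Fin n → ℕ} → (∀ i → f i ≤ c) → sum f ≤ n * c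
sum-≤ {n} {c} f≤c = ≤-trans (sum-mono f≤c) (≤-reflexive (sum-const n c))

f≤sum : ∀ {n} (f : Fin n → ℕ) i → f i ≤ sum f
f≤sum f zero    = m≤m+n _ _
f≤sum f (suc i) = ≤-trans (f≤sum (f ∘ suc) i) (m≤n+m _ (f zero))

-- The averaging step of the method of conditional expectations: if every colour had `F c ≥ X`, the
-- weighted sum would reach `sum w * X`.
below-average : ∀ {k} (w F : Fin k → ℕ) {X} →
  sum (λ c → w c * F c) < sum w * X → ∃ λ c → F c < X
below-average w F {X} lt with any? (λ c → F c <? X)
... | yes found = found
... | no none   = contradiction lt (≤⇒≯ (begin
  sum w * X              ≡⟨ *-distribʳ-sum X w ⟩
  sum (λ c → w c * X)    ≤⟨ sum-mono (λ c → *-monoʳ-≤ (w c) (≮⇒≥ (λ lt → none (c , lt)))) ⟩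
  sum (λ c → w c * F c)  ∎))
  where open ≤-Reasoning

-- `avoid w j / sum w` is the probability that a colour drawn with weights `w` differs from `j`.
avoid : ∀ {k} → (Fin k → ℕ) → Fin k → ℕ
avoid w j = sum (λ c → w c * 𝟙 (not (does (c Fin.≟ j))))

sum-*1 : ∀ {k} (w : Fin k → ℕ) → sum (λ c → w c * 1) ≡ sum w
sum-*1 w = sum-cong-≗ (λ c → *-identityʳ (w c))

avoid-+ : ∀ {k} (w : Fin k → ℕ) j → avoid w j + w j ≡ sum w
avoid-+ w zero rewrite *-zeroʳ (w zero) | sum-*1 (w ∘ suc) = +-comm _ (w zero)
avoid-+ w (suc j) rewrite *-identityʳ (w zero) =
  trans (+-assoc (w zero) _ _) (cong (w zero +_) (avoid-+ (w ∘ suc) j))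

-- The left-hand side of the hypothesis is, up to the factor (sum w) ^ n, the
-- expected number of missed requirements in a random colouring with colours
-- distributed proportionally to w; the colours are fixed one vertex at a time
-- so that the conditional expectation does not increase.
hitting-colouring : ∀ {n k R} (w : Fin k → ℕ) (S : Fin R → Fin n → Bool)
  (colour : Fin R → Fin k) (pending : Fin R → Bool) →
  sum (λ r → 𝟙 (pending r) *
             product (λ v → if S r v then avoid w (colour r) else sum w))
    < sum w ^ n →
  ∃ λ (f : Fin n → Fin k) →
    ∀ r → pending r ≡ true → ∃ λ v → S r v ≡ true × f v ≡ colour r
-- With no vertices left every product is 1, so the hypothesis says that fewer than one requirement
-- is pending.
hitting-colouring {zero} w S colour pending lt = (λ ()) , λ r o →
  contradiction (subst (λ b → 𝟙 b * 1 < 1) o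
    (≤-<-trans (f≤sum (λ r → 𝟙 (pending r) * 1) r) lt)) λ { (s≤s ()) }
hitting-colouring {suc n} {k} {R} w S colour pending lt = f , found
  where
  open ≤-Reasoning
  P : Fin R → ℕ
  P r = product (λ v → if S r (suc v) then avoid w (colour r) else sum w)
  pending′ : Fin k → Fin R → Bool
  pending′ c r = pending r ∧ not (S r zero ∧ does (c Fin.≟ colour r))
  -- Averaging `pending′` over the colour of the first vertex restores that vertex's factor in the
  -- product. Hence the weighted sum of `F` is the left-hand side of the hypothesis.
  factor : ∀ r → sum (λ c → w c * 𝟙 (pending′ c r)) ≡
                 𝟙 (pending r) * (if S r zero then avoid w (colour r) else sum w)
  factor r with pending r | S r zero
  ... | false | _     = trans (sum-cong-≗ (λ c → *-zeroʳ (w c))) (trans (sum-const k 0) (*-zeroʳ k))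
  ... | true  | false = trans (sum-*1 w) (sym (+-identityʳ _))
  ... | true  | true  = sym (+-identityʳ _)
  F : Fin k → ℕ
  F c = sum (λ r → 𝟙 (pending′ c r) * P r)
  average : sum (λ c → w c * F c) < sum w * sum w ^ n
  average = begin-strict
    sum (λ c → w c * F c)
      ≡⟨ sum-cong-≗ (λ c → *-distribˡ-sum (w c) (λ r → 𝟙 (pending′ c r) * P r)) ⟩
    sum (λ c → sum (λ r → w c * (𝟙 (pending′ c r) * P r)))
      ≡⟨ ∑-comm (λ c r → w c * (𝟙 (pending′ c r) * P r)) ⟩
    sum (λ r → sum (λ c → w c * (𝟙 (pending′ c r) * P r)))
      ≡⟨ sum-cong-≗ {R} (λ r → sum-cong-≗ {k} (λ c → sym (*-assoc (w c) (𝟙 (pending′ c r)) (P r)))) ⟩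
    sum (λ r → sum (λ c → w c * 𝟙 (pending′ c r) * P r))
      ≡⟨ sum-cong-≗ (λ r → sym (*-distribʳ-sum (P r) (λ c → w c * 𝟙 (pending′ c r)))) ⟩
    sum (λ r → sum (λ c → w c * 𝟙 (pending′ c r)) * P r)
      ≡⟨ sum-cong-≗ (λ r → trans (cong (_* P r) (factor r)) (*-assoc (𝟙 (pending r)) _ _)) ⟩
    sum (λ r → 𝟙 (pending r) * ((if S r zero then avoid w (colour r) else sum w) * P r))
      <⟨ lt ⟩
    sum w * sum w ^ n ∎
  choice = below-average w F average
  c₀ = proj₁ choice
  rest = hitting-colouring w (λ r → S r ∘ suc) colour (pending′ c₀) (proj₂ choice)
  f : Fin (suc n) → Fin k
  f zero    = c₀
  f (suc v) = proj₁ rest v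
  found : ∀ r → pending r ≡ true → ∃ λ v → S r v ≡ true × f v ≡ colour r
  found r o with S r zero in s | c₀ Fin.≟ colour r in q
  ... | true  | yes eq = zero , s , eq
  ... | true  | no ne  =
    let v , p = proj₂ rest r (cong₂ _∧_ o (cong not (cong₂ _∧_ s (cong does q)))) in suc v , p
  ... | false | _      =
    let v , p = proj₂ rest r (cong₂ _∧_ o (cong (λ b → not (b ∧ does (c₀ Fin.≟ colour r))) s)) in suc v , p

-- The probability that a set misses a colour

-- Bernoulli's inequality for (1 + b / a) ^ (y + 1) with denominators cleared. The induction
-- multiplies by `a + b` and drops the term in `b * b`.
bernoulli : ∀ a b y → a ^ suc y + suc y * b * a ^ y ≤ (a + b) ^ suc y
bernoulli a b zero    = ≤-reflexive (lemma a b)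
  where
  lemma : ∀ a b → a * 1 + (b + 0) * 1 ≡ (a + b) * 1
  lemma = solve-∀
bernoulli a b (suc y) = begin
  a ^ suc (suc y) + suc (suc y) * b * a ^ suc y
    ≤⟨ m≤m+n _ (suc y * b * b * a ^ y) ⟩
  a ^ suc (suc y) + suc (suc y) * b * a ^ suc y + suc y * b * b * a ^ y
    ≡⟨ lemma a b y (a ^ y) ⟩
  (a + b) * (a ^ suc y + suc y * b * a ^ y)
    ≤⟨ *-monoʳ-≤ (a + b) (bernoulli a b y) ⟩
  (a + b) ^ suc (suc y) ∎
  where
  open ≤-Reasoning
  lemma : ∀ a b y p → a * (a * p) + (b + (b + y * b)) * (a * p) + (b + y * b) * b * p ≡
                      (a + b) * (a * p + (b + y * b) * p)
  lemma = solve-∀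

-- If a colour has probability b / (a + b) ≥ 1 / x, then x vertices all miss it with probability at
-- most 1 / 2: the second Bernoulli term x b a ^ (x - 1) alone is at least a ^ x.
2*a^x≤[a+b]^x : ∀ a b x → .{{NonZero (a + b)}} → a + b ≤ b * x → 2 * a ^ x ≤ (a + b) ^ x
2*a^x≤[a+b]^x a b zero le =
  contradiction (subst (a + b ≤_) (*-zeroʳ b) le) (<⇒≱ (>-nonZero⁻¹ (a + b)))
2*a^x≤[a+b]^x a b (suc y) le = begin
  a ^ suc y + (a * a ^ y + 0)        ≡⟨ cong (a ^ suc y +_) (+-identityʳ _) ⟩
  a ^ suc y + a * a ^ y              ≤⟨ +-monoʳ-≤ (a ^ suc y) (*-monoˡ-≤ (a ^ y) a≤) ⟩
  a ^ suc y + suc y * b * a ^ y      ≤⟨ bernoulli a b y ⟩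
  (a + b) ^ suc y                    ∎
  where
  open ≤-Reasoning
  a≤ : a ≤ suc y * b
  a≤ = ≤-trans (m≤m+n a b) (≤-trans le (≤-reflexive (*-comm b (suc y))))

-- The product is a ^ |S| * W ^ (n - |S|); the factor `W ^ count S` avoids the subtraction.
product-if : ∀ {n} (S : Fin n → Bool) a W →
  product (λ v → if S v then a else W) * W ^ count S ≡ a ^ count S * W ^ n
product-if {zero}  S a W = refl
product-if {suc n} S a W with S zero
... | true  = trans (lemma a W P (W ^ s)) (trans (cong (a * W *_) ih) (lemma′ a W (a ^ s) (W ^ n)))
  where
  P = product (λ v → if S (suc v) then a else W)
  s = count (S ∘ suc)
  ih = product-if (S ∘ suc) a W
  lemma : ∀ a W p q → a * p * (W * q) ≡ a * W * (p * q)
  lemma = solve-∀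
  lemma′ : ∀ a W p q → a * W * (p * q) ≡ a * p * (W * q)
  lemma′ = solve-∀
... | false = trans (lemma W P (W ^ s)) (trans (cong (W *_) ih) (lemma′ W (a ^ s) (W ^ n)))
  where
  P = product (λ v → if S (suc v) then a else W)
  s = count (S ∘ suc)
  ih = product-if (S ∘ suc) a W
  lemma : ∀ W p q → W * p * q ≡ W * (p * q)
  lemma = solve-∀
  lemma′ : ∀ W p q → W * (p * q) ≡ p * (W * q)
  lemma′ = solve-∀

-- `S` contains e disjoint blocks of x vertices, each of which misses the colour with probability at
-- most 1 / 2; in `power` the r vertices left over contribute a factor of at most 1.
2^e*product≤ : ∀ {n} (S : Fin n → Bool) a b e x → .{{NonZero (a + b)}} →
  a + b ≤ b * x → e * x ≤ count S →
  2 ^ e * product (λ v → if S v then a else a + b) ≤ (a + b) ^ n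
2^e*product≤ {n} S a b e x le ex≤ = *-cancelʳ-≤ _ _ (W ^ s) {{m^n≢0 W s}} (begin
  2 ^ e * P * W ^ s          ≡⟨ *-assoc (2 ^ e) P (W ^ s) ⟩
  2 ^ e * (P * W ^ s)        ≡⟨ cong (2 ^ e *_) (product-if S a W) ⟩
  2 ^ e * (a ^ s * W ^ n)    ≡⟨ *-assoc (2 ^ e) (a ^ s) (W ^ n) ⟨
  2 ^ e * a ^ s * W ^ n      ≤⟨ *-monoˡ-≤ (W ^ n) power ⟩
  W ^ s * W ^ n              ≡⟨ *-comm (W ^ s) (W ^ n) ⟩
  W ^ n * W ^ s              ∎)
  where
  open ≤-Reasoning
  W = a + b
  s = count S
  P = product (λ v → if S v then a else a + b)
  blocks : ∀ e → 2 ^ e * a ^ (e * x) ≤ W ^ (e * x)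
  blocks zero    = ≤-refl
  blocks (suc e) = begin
    2 * 2 ^ e * a ^ (x + e * x)              ≡⟨ cong (2 * 2 ^ e *_) (^-distribˡ-+-* a x (e * x)) ⟩
    2 * 2 ^ e * (a ^ x * a ^ (e * x))        ≡⟨ lemma (2 ^ e) (a ^ x) (a ^ (e * x)) ⟩
    2 * a ^ x * (2 ^ e * a ^ (e * x))        ≤⟨ *-mono-≤ (2*a^x≤[a+b]^x a b x le) (blocks e) ⟩
    W ^ x * W ^ (e * x)                      ≡⟨ ^-distribˡ-+-* W x (e * x) ⟨
    W ^ (x + e * x)                          ∎
    where
    lemma : ∀ t p q → 2 * t * (p * q) ≡ 2 * p * (t * q)
    lemma = solve-∀
  power : 2 ^ e * a ^ s ≤ W ^ s
  power with m≤n⇒∃[o]m+o≡n ex≤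
  ... | r , eq = subst (λ s → 2 ^ e * a ^ s ≤ W ^ s) eq (begin
    2 ^ e * a ^ (e * x + r)          ≡⟨ cong (2 ^ e *_) (^-distribˡ-+-* a (e * x) r) ⟩
    2 ^ e * (a ^ (e * x) * a ^ r)    ≡⟨ *-assoc (2 ^ e) _ _ ⟨
    2 ^ e * a ^ (e * x) * a ^ r      ≤⟨ *-mono-≤ (blocks e) (^-monoˡ-≤ r (m≤m+n a b)) ⟩
    W ^ (e * x) * W ^ r              ≡⟨ ^-distribˡ-+-* W (e * x) r ⟨
    W ^ (e * x + r)                  ∎)

-- Cuts and spreading sets

-- Ordered pairs are counted, so a symmetric relation on one vertex set counts each edge twice.
edges : ∀ {p q} → (Fin p → Fin q → Bool) → ℕ
edges E = sum (λ u → count (E u))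

-- Greedy: each vertex joins the side on which it cuts at least half of its edges to the vertices
-- already placed. `edges E` counts every edge twice and the cut only in the direction out of `X`,
-- which turns the half into a quarter.
directed-cut : ∀ {n} (E : Fin n → Fin n → Bool) →
  (∀ u v → E u v ≡ E v u) → (∀ v → E v v ≡ false) →
  ∃ λ (X : Fin n → Bool) → edges E ≤ 4 * edges (λ u v → X u ∧ not (X v) ∧ E u v)
directed-cut {zero}  E E-sym E-irr = (λ ()) , z≤n
directed-cut {suc n} E E-sym E-irr = result (≤-total A B)
  where
  open ≤-Reasoning
  ih = directed-cut (λ u v → E (suc u) (suc v)) (λ u v → E-sym (suc u) (suc v)) (E-irr ∘ suc)
  X = proj₁ ih
  total = edges (λ u v → E (suc u) (suc v))
  cut = edges (λ u v → X u ∧ not (X v) ∧ E (suc u) (suc v))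
  A B r : ℕ
  A = count (λ v → not (X v) ∧ E zero (suc v))
  B = count (λ u → X u ∧ E (suc u) zero)
  r = count (λ v → E zero (suc v))
  A+B : r ≡ A + B
  A+B = trans (sum-cong-≗ split) (∑-distrib-+ (λ v → 𝟙 (not (X v) ∧ E zero (suc v))) _)
    where
    split : ∀ v → 𝟙 (E zero (suc v)) ≡ 𝟙 (not (X v) ∧ E zero (suc v)) + 𝟙 (X v ∧ E (suc v) zero)
    split v with X v
    ... | true  = cong 𝟙 (E-sym zero (suc v))
    ... | false = sym (+-identityʳ _)
  whole : edges E ≡ r + (r + total)
  whole = cong₂ _+_ (cong (λ b → 𝟙 b + r) (E-irr zero))
    (trans (∑-distrib-+ (λ u → 𝟙 (E (suc u) zero)) _)
           (cong (_+ total) (sum-cong-≗ (λ u → cong 𝟙 (E-sym (suc u) zero)))))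
  -- `x` counts the edges of the new vertex that its chosen side cuts and `y` the others, so `y ≤ x`
  -- gives r ≤ 2 x.
  arith : ∀ {x y z} → r ≡ x + y → y ≤ x → total ≤ 4 * cut → x + cut ≤ z → r + (r + total) ≤ 4 * z
  arith {x} {y} {z} r≡ y≤x t≤ x+c≤z = begin
    r + (r + total)                ≡⟨ cong (λ r → r + (r + total)) r≡ ⟩
    (x + y) + ((x + y) + total)
      ≤⟨ +-mono-≤ (+-monoʳ-≤ x y≤x) (+-mono-≤ (+-monoʳ-≤ x y≤x) t≤) ⟩
    (x + x) + ((x + x) + 4 * cut)  ≡⟨ lemma x cut ⟩
    4 * (x + cut)                  ≤⟨ *-monoʳ-≤ 4 x+c≤z ⟩
    4 * z                          ∎
    where
    lemma : ∀ x c → (x + x) + ((x + x) + 4 * c) ≡ 4 * (x + c)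
    lemma = solve-∀
  extend : Bool → Fin (suc n) → Bool
  extend b zero    = b
  extend b (suc v) = X v
  result : A ≤ B ⊎ B ≤ A →
    ∃ λ (Y : Fin (suc n) → Bool) → edges E ≤ 4 * edges (λ u v → Y u ∧ not (Y v) ∧ E u v)
  result (inj₁ A≤B) = extend false , ≤-trans (≤-reflexive whole)
    (arith (trans A+B (+-comm A B)) A≤B (proj₂ ih)
      (≤-trans (≤-reflexive (sym (∑-distrib-+ (λ u → 𝟙 (X u ∧ E (suc u) zero)) _)))
               (m≤n+m _ (sum {n} (λ _ → 0)))))
  result (inj₂ B≤A) = extend true , ≤-trans (≤-reflexive whole)
    (arith A+B B≤A (proj₂ ih) (+-monoʳ-≤ A (sum-mono (λ u → m≤n+m _ (𝟙 (X u ∧ false))))))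

-- Counting with Boolean predicates

count-∨ : ∀ {n} (p q : Fin n → Bool) → count (λ v → p v ∨ q v) ≡ count p + count (λ v → not (p v) ∧ q v)
count-∨ p q = trans (sum-cong-≗ split) (∑-distrib-+ (𝟙 ∘ p) _)
  where
  split : ∀ v → 𝟙 (p v ∨ q v) ≡ 𝟙 (p v) + 𝟙 (not (p v) ∧ q v)
  split v with p v
  ... | true  = refl
  ... | false = refl

𝟙-mono : ∀ {a b} → (a ≡ true → b ≡ true) → 𝟙 a ≤ 𝟙 b
𝟙-mono {false} {b} h = z≤n
𝟙-mono {true}  {b} h rewrite h refl = ≤-refl

count-mono : ∀ {n} {p q : Fin n → Bool} → (∀ v → p v ≡ true → q v ≡ true) → count p ≤ count q
count-mono h = sum-mono (λ v → 𝟙-mono (h v))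

∧-trueˡ : ∀ {a b} → a ∧ b ≡ true → a ≡ true
∧-trueˡ {true} _ = refl

∧-trueʳ : ∀ {a b} → a ∧ b ≡ true → b ≡ true
∧-trueʳ {true} eq = eq

count-∨-≤ : ∀ {n} (p q : Fin n → Bool) → count (λ v → p v ∨ q v) ≤ count p + count q
count-∨-≤ p q = ≤-trans (≤-reflexive (count-∨ p q))
  (+-monoʳ-≤ (count p) (count-mono (λ v → ∧-trueʳ {not (p v)})))

count-≟ : ∀ {n} (u : Fin n) → count (λ v → does (v Fin.≟ u)) ≤ 1
count-≟ {suc n} zero    = ≤-reflexive (cong suc (trans (sum-const n 0) (*-zeroʳ n)))
count-≟         (suc u) = count-≟ u

∨-true : ∀ {a b} → a ∨ b ≡ true → a ≡ true ⊎ b ≡ true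
∨-true {true}  _  = inj₁ refl
∨-true {false} eq = inj₂ eq

∨-false : ∀ {a b} → a ∨ b ≡ false → a ≡ false × b ≡ false
∨-false {false} eq = refl , eq

does⇒ : ∀ {a} {A : Set a} (a? : Dec A) → does a? ≡ true → A
does⇒ (yes a) _ = a

-- Greedy growth in a relation of bounded degree

module BoundedDegree {p q} (E : Fin p → Fin q → Bool) (D : ℕ)
  (row≤ : ∀ u → count (E u) ≤ D) (column≤ : ∀ v → count (λ u → E u v) ≤ D) where

  -- The vertices of `U` and `N` meet at most `(count U + count N) * D` edges. If every row outside
  -- `U` had at most `s` entries outside `N`, the remaining edges would number at most `p * s`.
  fresh-vertex : ∀ U N s → (count U + count N) * D + p * s < edges E →
    ∃ λ u → U u ≡ false × s < count (λ v → not (N v) ∧ E u v)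
  fresh-vertex U N s lt
    with any? (λ u → (U u Bool.≟ false) ×-dec (s <? count (λ v → not (N v) ∧ E u v)))
  ... | yes found = found
  ... | no none   = contradiction lt (≤⇒≯ (begin
    edges E
      ≤⟨ sum-mono row ⟩
    sum (λ u → 𝟙 (U u) * D + (sum (λ v → 𝟙 (N v) * 𝟙 (E u v)) + s))
      ≡⟨ ∑-distrib-+ (λ u → 𝟙 (U u) * D) _ ⟩
    sum (λ u → 𝟙 (U u) * D) + sum (λ u → sum (λ v → 𝟙 (N v) * 𝟙 (E u v)) + s)
      ≡⟨ cong₂ _+_ (sym (*-distribʳ-sum D (𝟙 ∘ U))) (∑-distrib-+ (λ u → sum (λ v → 𝟙 (N v) * 𝟙 (E u v))) (λ _ → s)) ⟩
    count U * D + (sum (λ u → sum (λ v → 𝟙 (N v) * 𝟙 (E u v))) + sum {p} (λ _ → s))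
      ≤⟨ +-monoʳ-≤ (count U * D) (+-mono-≤ columns (≤-reflexive (sum-const p s))) ⟩
    count U * D + (count N * D + p * s)
      ≡⟨ lemma (count U) (count N) D (p * s) ⟩
    (count U + count N) * D + p * s ∎))
    where
    open ≤-Reasoning
    lemma : ∀ a b D c → a * D + (b * D + c) ≡ (a + b) * D + c
    lemma = solve-∀
    split : ∀ u v → 𝟙 (E u v) ≡ 𝟙 (N v) * 𝟙 (E u v) + 𝟙 (not (N v) ∧ E u v)
    split u v with N v
    ... | true  = sym (trans (+-identityʳ _) (+-identityʳ _))
    ... | false = refl
    row : ∀ u → count (E u) ≤ 𝟙 (U u) * D + (sum (λ v → 𝟙 (N v) * 𝟙 (E u v)) + s)
    row u with U u in eq
    ... | true  = ≤-trans (row≤ u) (≤-trans (≤-reflexive (sym (+-identityʳ D))) (m≤m+n _ _))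
    ... | false = ≤-trans
      (≤-reflexive (trans (sum-cong-≗ (split u)) (∑-distrib-+ (λ v → 𝟙 (N v) * 𝟙 (E u v)) _)))
      (+-monoʳ-≤ _ (≮⇒≥ (λ s< → none (u , eq , s<))))
    columns : sum (λ u → sum (λ v → 𝟙 (N v) * 𝟙 (E u v))) ≤ count N * D
    columns = begin
      sum (λ u → sum (λ v → 𝟙 (N v) * 𝟙 (E u v)))    ≡⟨ ∑-comm (λ u v → 𝟙 (N v) * 𝟙 (E u v)) ⟩
      sum (λ v → sum (λ u → 𝟙 (N v) * 𝟙 (E u v)))    ≡⟨ sum-cong-≗ (λ v → sym (*-distribˡ-sum (𝟙 (N v)) (λ u → 𝟙 (E u v)))) ⟩
      sum (λ v → 𝟙 (N v) * count (λ u → E u v))      ≤⟨ sum-mono (λ v → *-monoʳ-≤ (𝟙 (N v)) (column≤ v)) ⟩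
      sum (λ v → 𝟙 (N v) * D)                        ≡⟨ *-distribʳ-sum D (𝟙 ∘ N) ⟨
      count N * D                                    ∎

  -- Fresh vertices are added, each with more than `s` new neighbours, until t are taken or `N` has
  -- size T. Growth continues only while `count N < T`, which is why `T` can stand for the size of
  -- `N` in the hypothesis.
  spreading-set : ∀ U T s t → (count U + t + T) * D + p * s < edges E →
    ∃₂ λ (A : Fin p → Bool) (N : Fin q → Bool) →
      (∀ u → A u ≡ true → U u ≡ false) × count A ≤ t ×
      (∀ v → N v ≡ true → ∃ λ u → A u ≡ true × E u v ≡ true) ×
      (T ≤ count N ⊎ t * suc s ≤ count N)
  spreading-set U T s zero lt = (λ _ → false) , (λ _ → false) , (λ _ ()) ,
    ≤-reflexive (trans (sum-const p 0) (*-zeroʳ p)) , (λ _ ()) , inj₂ z≤n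
  spreading-set U T s (suc t) lt
    with spreading-set U T s t (≤-<-trans (+-monoˡ-≤ (p * s) (*-monoˡ-≤ D (+-monoˡ-≤ T (+-monoʳ-≤ (count U) (n≤1+n t))))) lt)
  ... | A , N , disjoint , A≤ , N-near , large with T ≤? count N
  ... | yes T≤N = A , N , disjoint , m≤n⇒m≤1+n A≤ , N-near , inj₁ T≤N
  ... | no  T≰N
    with fresh-vertex (λ u → U u ∨ A u) N s (≤-<-trans (+-monoˡ-≤ (p * s) (*-monoˡ-≤ D
           (+-mono-≤ (≤-trans (count-∨-≤ U A) (+-monoʳ-≤ (count U) (m≤n⇒m≤1+n A≤))) (<⇒≤ (≰⇒> T≰N))))) lt)
  ... | x , x∉ , gain = A′ , N′ , disjoint′ , A′≤ , N′-near , inj₂ large′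
    where
    A′ : Fin p → Bool
    A′ u = A u ∨ does (u Fin.≟ x)
    N′ : Fin q → Bool
    N′ v = N v ∨ E x v
    disjoint′ : ∀ u → A′ u ≡ true → U u ≡ false
    disjoint′ u eq with ∨-true {A u} eq
    ... | inj₁ Au  = disjoint u Au
    ... | inj₂ u≟x = subst (λ u → U u ≡ false) (sym (does⇒ (u Fin.≟ x) u≟x)) (proj₁ (∨-false x∉))
    A′≤ : count A′ ≤ suc t
    A′≤ = ≤-trans (count-∨-≤ A _) (≤-trans (+-mono-≤ A≤ (count-≟ x)) (≤-reflexive (+-comm t 1)))
    N′-near : ∀ v → N′ v ≡ true → ∃ λ u → A′ u ≡ true × E u v ≡ true
    N′-near v eq with ∨-true {N v} eq
    ... | inj₁ Nv  = let u , Au , Euv = N-near v Nv in u , cong (_∨ _) Au , Euv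
    ... | inj₂ Exv = x , trans (cong (A x ∨_) (dec-true (x Fin.≟ x) refl)) (Bool.∨-zeroʳ (A x)) , Exv
    old : t * suc s ≤ count N
    old = [ (λ T≤N → contradiction T≤N T≰N) , id ]′ large
    large′ : suc t * suc s ≤ count N′
    large′ = ≤-trans (+-mono-≤ gain old)
      (≤-reflexive (trans (+-comm _ (count N)) (sym (count-∨ N (E x)))))

  -- Only the sets encoded by `a` must be disjoint: each round takes the domain of `a` as `U` but
  -- starts `N` afresh, so the `S i` may overlap. By `T ≤ t * suc s` both ways of stopping yield
  -- size T.
  spreading-family : ∀ T s t r → T ≤ t * suc s → (r * t + T) * D + p * s < edges E →
    ∃₂ λ (a : Fin p → Maybe (Fin r)) (S : Fin r → Fin q → Bool) →
      count (is-just ∘ a) ≤ r * t × (∀ i → T ≤ count (S i)) ×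
      (∀ i v → S i v ≡ true → ∃ λ u → a u ≡ just i × E u v ≡ true)
  spreading-family T s t zero    T≤ lt =
    (λ _ → nothing) , (λ ()) , ≤-reflexive (trans (sum-const p 0) (*-zeroʳ p)) , (λ ()) , λ ()
  spreading-family T s t (suc r) T≤ lt
    with spreading-family T s t r T≤ (≤-<-trans (+-monoˡ-≤ (p * s) (*-monoˡ-≤ D (+-monoˡ-≤ T (m≤n+m (r * t) t)))) lt)
  ... | a , S , a≤ , S-large , S-near
    with spreading-set (is-just ∘ a) T s t (≤-<-trans (+-monoˡ-≤ (p * s) (*-monoˡ-≤ D (+-monoˡ-≤ T
           (≤-trans (+-monoˡ-≤ t a≤) (≤-reflexive (+-comm (r * t) t)))))) lt)
  ... | A , N , disjoint , A≤ , N-near , large = a′ , S′ , a′≤ , S′-large , S′-near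
    where
    a′ : Fin p → Maybe (Fin (suc r))
    a′ u = if A u then just zero else Maybe.map suc (a u)
    S′ : Fin (suc r) → Fin q → Bool
    S′ zero    = N
    S′ (suc i) = S i
    a′≤ : count (is-just ∘ a′) ≤ suc r * t
    a′≤ = ≤-trans (count-mono covered) (≤-trans (count-∨-≤ A (is-just ∘ a)) (+-mono-≤ A≤ a≤))
      where
      covered : ∀ u → is-just (a′ u) ≡ true → A u ∨ is-just (a u) ≡ true
      covered u eq with A u | a u
      ... | true  | _      = refl
      ... | false | just _ = refl
    S′-large : ∀ i → T ≤ count (S′ i)
    S′-large zero    = [ id , ≤-trans T≤ ]′ large
    S′-large (suc i) = S-large i
    S′-near : ∀ i v → S′ i v ≡ true → ∃ λ u → a′ u ≡ just i × E u v ≡ true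
    S′-near zero v Nv =
      let u , Au , Euv = N-near v Nv in u , cong (if_then just zero else Maybe.map suc (a u)) Au , Euv
    S′-near (suc i) v Sv with S-near i v Sv
    ... | u , au , Euv with A u in Au
    ... | true  = contradiction (trans (sym (cong is-just au)) (disjoint u Au)) λ ()
    ... | false = u , trans (cong (if_then just zero else Maybe.map suc (a u)) Au) (cong (Maybe.map suc) au) , Euv

-- Supplies the centres of the high colours; the encoding as a partial map keeps the centres of
-- different colours distinct.
choose : ∀ {n} (p : Fin n → Bool) h → h ≤ count p →
  ∃ λ (a : Fin n → Maybe (Fin h)) →
    (∀ i → ∃ λ u → a u ≡ just i) × (∀ u → is-just (a u) ≡ true → p u ≡ true) ×
    count (is-just ∘ a) ≤ h
choose {n} p zero h≤ = (λ _ → nothing) , (λ ()) , (λ _ ()) , ≤-reflexive (trans (sum-const n 0) (*-zeroʳ n))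
choose {suc n} p (suc h) h≤ with p zero in p₀
... | false with choose (p ∘ suc) (suc h) h≤
...   | a , onto , a⊆p , a≤ = a′ , (λ i → let u , eq = onto i in suc u , eq) , a′⊆p , a≤
  where
  a′ : Fin (suc n) → Maybe (Fin (suc h))
  a′ zero    = nothing
  a′ (suc u) = a u
  a′⊆p : ∀ u → is-just (a′ u) ≡ true → p u ≡ true
  a′⊆p (suc u) = a⊆p u
choose {suc n} p (suc h) (s≤s h≤) | true with choose (p ∘ suc) h h≤
...   | a , onto , a⊆p , a≤ = a′ , onto′ , a′⊆p , s≤s (≤-trans (count-mono covered) a≤)
  where
  a′ : Fin (suc n) → Maybe (Fin (suc h))
  a′ zero    = just zero
  a′ (suc u) = Maybe.map suc (a u)
  onto′ : ∀ i → ∃ λ u → a′ u ≡ just i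
  onto′ zero    = zero , refl
  onto′ (suc i) = let u , eq = onto i in suc u , cong (Maybe.map suc) eq
  covered : ∀ u → is-just (a′ (suc u)) ≡ true → is-just (a u) ≡ true
  covered u eq with a u
  ... | just _ = refl
  a′⊆p : ∀ u → is-just (a′ u) ≡ true → p u ≡ true
  a′⊆p zero    _  = p₀
  a′⊆p (suc u) eq = a⊆p u (covered u eq)

-- Two kinds of colours

-- Pairs are ordered because the high colours will be numbered first: when the smaller colour of a
-- pair is low, so is the larger. Thus the set of a low colour has only low colours to meet.
Joined : ∀ {n} → (Fin n → Fin n → Bool) → ℕ → Set
Joined {n} adj k = ∃ λ (f : Fin n → Fin k) →
  ∀ i j → i Fin.< j → ∃₂ λ u v → adj u v ≡ true × f u ≡ i × f v ≡ j

-- Each pair is a requirement: the set of the smaller colour must contain a vertex of the larger. A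
-- random colouring misses it with probability at most 2 ^ (- e), and there are at most k * k < 2 ^
-- e pairs, so the expected number of misses is below 1.
complete-colouring : ∀ {n k} (adj : Fin n → Fin n → Bool)
  (a : Fin n → Maybe (Fin k)) (S : Fin k → Fin n → Bool) (w x : Fin k → ℕ) e →
  .{{NonZero (sum w)}} → k * k < 2 ^ e →
  (∀ i v → S i v ≡ true → a v ≡ nothing × ∃ λ u → a u ≡ just i × adj u v ≡ true) →
  (∀ i j → i Fin.< j → sum w ≤ w j * x i × e * x i ≤ count (S i)) →
  Joined adj k
complete-colouring {n} {k} adj a S w x e kk< near large = f , joined
  where
  open ≤-Reasoning
  W = sum w
  row col : Fin (k * k) → Fin k
  row r = proj₁ (remQuot k r)
  col r = proj₂ (remQuot {k} k r)
  pending : Fin (k * k) → Bool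
  pending r = does (row r Fin.<? col r)
  P : Fin (k * k) → ℕ
  P r = product (λ v → if S (row r) v then avoid w (col r) else W)
  term : ∀ r → 2 ^ e * (𝟙 (pending r) * P r) ≤ W ^ n
  term r with pending r in pending-r
  ... | false = ≤-trans (≤-reflexive (*-zeroʳ (2 ^ e))) z≤n
  ... | true  = ≤-trans (≤-reflexive (cong (2 ^ e *_) (+-identityʳ (P r)))) bound
    where
    j = col r
    i<j = does⇒ (row r Fin.<? j) pending-r
    W≡ = avoid-+ w j
    bound : 2 ^ e * P r ≤ W ^ n
    bound = subst (λ W → 2 ^ e * product (λ v → if S (row r) v then avoid w j else W) ≤ W ^ n) W≡
      (2^e*product≤ (S (row r)) (avoid w j) (w j) e (x (row r))
        {{subst NonZero (sym W≡) (>-nonZero (>-nonZero⁻¹ W))}}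
        (subst (_≤ w j * x (row r)) (sym W≡) (proj₁ (large _ _ i<j)))
        (proj₂ (large _ _ i<j)))
  few-missed : sum (λ r → 𝟙 (pending r) * P r) < W ^ n
  few-missed = *-cancelˡ-< (2 ^ e) _ _ (begin-strict
    2 ^ e * sum (λ r → 𝟙 (pending r) * P r)     ≡⟨ *-distribˡ-sum (2 ^ e) (λ r → 𝟙 (pending r) * P r) ⟩
    sum (λ r → 2 ^ e * (𝟙 (pending r) * P r))   ≤⟨ sum-≤ term ⟩
    k * k * W ^ n                             <⟨ *-monoˡ-< (W ^ n) {{m^n≢0 W n}} kk< ⟩
    2 ^ e * W ^ n                             ∎)
  hit = hitting-colouring w (S ∘ row) col pending few-missed
  -- The colours fixed by `a` override the random ones. Each `S i` contains only vertices where `a`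
  -- is `nothing`, so what was hit stays hit.
  f : Fin n → Fin k
  f v = fromMaybe (proj₁ hit v) (a v)
  joined : ∀ i j → i Fin.< j → ∃₂ λ u v → adj u v ≡ true × f u ≡ i × f v ≡ j
  joined i j i<j = from-hit (proj₂ hit r pending-r)
    where
    r = combine i j
    rq : remQuot k r ≡ (i , j)
    rq = Fin.remQuot-combine i j
    pending-r : pending r ≡ true
    pending-r = dec-true (row r Fin.<? col r)
      (subst₂ Fin._<_ (sym (cong proj₁ rq)) (sym (cong proj₂ rq)) i<j)
    from-hit : (∃ λ v → S (row r) v ≡ true × proj₁ hit v ≡ col r) →
      ∃₂ λ u v → adj u v ≡ true × f u ≡ i × f v ≡ j
    from-hit (v , Sv , fv) with near (row r) v Sv
    ... | av , u , au , uv = u , v , uv ,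
      trans (cong (fromMaybe (proj₁ hit u)) au) (cong proj₁ rq) ,
      trans (cong (fromMaybe (proj₁ hit v)) av) (trans fv (cong proj₂ rq))

sum-splitAt : ∀ h {m} x y → sum ([ const x , const y ]′ ∘ splitAt h {m}) ≡ h * x + m * y
sum-splitAt zero    {m} x y = sum-const m y
sum-splitAt (suc h) {m} x y = trans (cong (x +_) (trans (sum-cong-≗ shift) (sum-splitAt h x y)))
  (sym (+-assoc x (h * x) (m * y)))
  where
  shift : ∀ i → [ const x , const y ]′ (splitAt (suc h) {m} (suc i)) ≡ [ const x , const y ]′ (splitAt h i)
  shift i with splitAt h i
  ... | inj₁ _ = refl
  ... | inj₂ _ = refl

splitAt-above : ∀ h {m} (i j : Fin (h + m)) → i Fin.< j → ∀ {i′} → splitAt h i ≡ inj₂ i′ →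
  ∃ λ j′ → splitAt h j ≡ inj₂ j′ × i′ Fin.< j′
splitAt-above h {m} i j i<j {i′} eq with splitAt h j in eqⱼ
... | inj₂ j′ = j′ , refl , +-cancelˡ-< h _ _ (subst₂ _<_ i≡ j≡ i<j)
  where
  i≡ : toℕ i ≡ h + toℕ i′
  i≡ = trans (cong toℕ (sym (Fin.splitAt⁻¹-↑ʳ eq))) (Fin.toℕ-↑ʳ h i′)
  j≡ : toℕ j ≡ h + toℕ j′
  j≡ = trans (cong toℕ (sym (Fin.splitAt⁻¹-↑ʳ eqⱼ))) (Fin.toℕ-↑ʳ h j′)
... | inj₁ j′ = contradiction (<-≤-trans i<j (<⇒≤ j<h)) (≤⇒≯ h≤i)
  where
  j<h : toℕ j < h
  j<h = subst (_< h) (trans (sym (Fin.toℕ-↑ˡ j′ m)) (cong toℕ (Fin.splitAt⁻¹-↑ˡ eqⱼ))) (Fin.toℕ<n j′)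
  h≤i : h ≤ toℕ i
  h≤i = subst (h ≤_) (trans (sym (Fin.toℕ-↑ʳ h i′)) (cong toℕ (Fin.splitAt⁻¹-↑ʳ eq))) (m≤m+n h (toℕ i′))

-- `c` marks the centres of the h high colours, `b` the prescribed sets of the m low ones. At most h
-- + B vertices are coloured beforehand, so the degree bound leaves every centre 2 e k free
-- neighbours.
two-level-colouring : ∀ {n} (adj : Fin n → Fin n → Bool) h m e B →
  .{{NonZero m}} → (h + m) * (h + m) < 2 ^ e →
  (c : Fin n → Maybe (Fin h)) (b : Fin n → Maybe (Fin m)) (S : Fin m → Fin n → Bool) →
  (∀ i → ∃ λ u → c u ≡ just i × e * (2 * (h + m)) + (h + B) ≤ count (adj u)) →
  count (is-just ∘ c) ≤ h → count (is-just ∘ b) ≤ B →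
  (∀ i j → i Fin.< j → e * (2 * m) ≤ count (S i)) →
  (∀ i v → S i v ≡ true → c v ≡ nothing × b v ≡ nothing ×
     ∃ λ u → c u ≡ nothing × b u ≡ just i × adj u v ≡ true) →
  Joined adj (h + m)
two-level-colouring {n} adj h m e B kk< c b S centre c≤ b≤ S-large S-near =
  complete-colouring adj a S⁺ w x e {{W-nonZero}} kk< near large
  where
  open ≤-Reasoning
  k = h + m
  a : Fin n → Maybe (Fin k)
  a u = maybe′ (λ i → just (i ↑ˡ m)) (Maybe.map (h ↑ʳ_) (b u)) (c u)
  a-c : ∀ {u i} → c u ≡ just i → a u ≡ just (i ↑ˡ m)
  a-c {u} = cong (maybe′ (λ i → just (i ↑ˡ m)) (Maybe.map (h ↑ʳ_) (b u)))
  a-b : ∀ {u} → c u ≡ nothing → a u ≡ Maybe.map (h ↑ʳ_) (b u)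
  a-b {u} = cong (maybe′ (λ i → just (i ↑ˡ m)) (Maybe.map (h ↑ʳ_) (b u)))
  high : Fin h → Fin n → Bool
  high i v = not (is-just (a v)) ∧ adj (proj₁ (centre i)) v
  S⁺ : Fin k → Fin n → Bool
  S⁺ i = [ high , S ]′ (splitAt h i)
  -- The total weight is h m + m k ≤ 2 m k, so every colour has probability at least 1 / (2 k) and a
  -- low colour at least 1 / (2 m). A high colour must meet colours of both kinds, a low one only
  -- low colours; this gives the two values of `x`.
  w x : Fin k → ℕ
  w = [ const m , const k ]′ ∘ splitAt h
  x = [ const (2 * k) , const (2 * m) ]′ ∘ splitAt h
  W≤ : sum w ≤ m * (2 * k)
  W≤ = begin
    sum w          ≡⟨ sum-splitAt h m k ⟩
    h * m + m * k  ≤⟨ +-monoˡ-≤ (m * k) (*-monoˡ-≤ m (m≤m+n h m)) ⟩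
    k * m + m * k  ≡⟨ lemma k m ⟩
    m * (2 * k)    ∎
    where
    lemma : ∀ k m → k * m + m * k ≡ m * (2 * k)
    lemma = solve-∀
  W-nonZero : NonZero (sum w)
  W-nonZero = >-nonZero (begin-strict
    0              <⟨ *-mono-≤ (>-nonZero⁻¹ m) (≤-trans (>-nonZero⁻¹ m) (m≤n+m m h)) ⟩
    m * k          ≤⟨ m≤n+m (m * k) (h * m) ⟩
    h * m + m * k  ≡⟨ sum-splitAt h m k ⟨
    sum w          ∎)
  near : ∀ i v → S⁺ i v ≡ true → a v ≡ nothing × ∃ λ u → a u ≡ just i × adj u v ≡ true
  near i v Sv with splitAt h i in eq
  ... | inj₂ i′ with S-near i′ v Sv
  ...   | cv , bv , u , cu , bu , uv = trans (a-b cv) (cong (Maybe.map (h ↑ʳ_)) bv) , u ,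
    trans (a-b cu) (trans (cong (Maybe.map (h ↑ʳ_)) bu) (cong just (Fin.splitAt⁻¹-↑ʳ eq))) , uv
  near i v Sv | inj₁ i′ = unused (a v) (∧-trueˡ Sv) , proj₁ (centre i′) ,
    trans (a-c (proj₁ (proj₂ (centre i′)))) (cong just (Fin.splitAt⁻¹-↑ˡ eq)) , ∧-trueʳ {not (is-just (a v))} Sv
    where
    unused : ∀ (y : Maybe (Fin k)) → not (is-just y) ≡ true → y ≡ nothing
    unused nothing _ = refl
  a≤ : count (is-just ∘ a) ≤ h + B
  a≤ = ≤-trans (count-mono split) (≤-trans (count-∨-≤ (is-just ∘ c) (is-just ∘ b)) (+-mono-≤ c≤ b≤))
    where
    split : ∀ u → is-just (a u) ≡ true → is-just (c u) ∨ is-just (b u) ≡ true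
    split u eq with c u | b u
    ... | just _  | _      = refl
    ... | nothing | just _ = refl
  high-large : ∀ i → e * (2 * k) ≤ count (high i)
  high-large i = +-cancelʳ-≤ (h + B) _ _ (begin
    e * (2 * k) + (h + B)                  ≤⟨ proj₂ (proj₂ (centre i)) ⟩
    count (adj u)                          ≤⟨ count-mono split ⟩
    count (λ v → is-just (a v) ∨ adj u v)  ≡⟨ count-∨ (is-just ∘ a) (adj u) ⟩
    count (is-just ∘ a) + count (high i)   ≡⟨ +-comm _ (count (high i)) ⟩
    count (high i) + count (is-just ∘ a)   ≤⟨ +-monoʳ-≤ (count (high i)) a≤ ⟩
    count (high i) + (h + B)               ∎)
    where
    u = proj₁ (centre i)
    split : ∀ v → adj u v ≡ true → is-just (a v) ∨ adj u v ≡ true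
    split v eq = trans (cong (is-just (a v) ∨_) eq) (Bool.∨-zeroʳ _)
  m≤w : ∀ j → m ≤ w j
  m≤w j with splitAt h j
  ... | inj₁ _ = ≤-refl
  ... | inj₂ _ = m≤n+m m h
  large : ∀ i j → i Fin.< j → sum w ≤ w j * x i × e * x i ≤ count (S⁺ i)
  large i j i<j with splitAt h i in eq
  ... | inj₁ i′ = ≤-trans W≤ (*-monoˡ-≤ (2 * k) (m≤w j)) , high-large i′
  ... | inj₂ i′ with splitAt-above h i j i<j eq
  ...   | j′ , eqⱼ , i<j′ =
    ≤-trans W≤ (≤-reflexive (trans (lemma m k) (cong (λ s → [ const m , const k ]′ s * (2 * m)) (sym eqⱼ)))) ,
    S-large i′ j′ i<j′
    where
    lemma : ∀ m k → m * (2 * k) ≡ k * (2 * m)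
    lemma = solve-∀

-- 76160 = 16 * (32 + 2) * 35 * 2 * 2.
room : ∀ {C D e d d′ k m n s x} → D ≡ 35 * (e * k) → n * d′ ≤ 8 * x → 76160 < C → C * (d * (e * e)) ≤ n → 1 ≤ d → 1 ≤ e → 1 ≤ d′ →
  k ≤ 2 * d → m ≤ 2 * d′ → s * 16 ≤ d′ →
  (m * (32 * e) + e * (2 * m)) * D + n * s < x
room {C} {D} {e} {d} {d′} {k} {m} {n} {s} {x} refl nd′≤ C-large n-large 1≤d 1≤e 1≤d′ k≤ m≤ s≤ =
  *-cancelˡ-< 16 _ _ (begin-strict
  16 * ((m * (32 * e) + e * (2 * m)) * (35 * (e * k)) + n * s)
    ≡⟨ expand e k m n s ⟩
  19040 * (e * e * (m * k)) + n * (s * 16)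
    ≤⟨ +-mono-≤ (*-monoʳ-≤ 19040 (*-monoʳ-≤ (e * e) (*-mono-≤ m≤ k≤))) (*-monoʳ-≤ n s≤) ⟩
  19040 * (e * e * (2 * d′ * (2 * d))) + n * d′
    ≡⟨ cong (_+ n * d′) (collect 19040 e d d′) ⟩
  76160 * (d * (e * e) * d′) + n * d′
    <⟨ +-monoˡ-< (n * d′) (*-monoˡ-< (d * (e * e) * d′) {{>-nonZero positive}} C-large) ⟩
  C * (d * (e * e) * d′) + n * d′
    ≡⟨ cong (_+ n * d′) (*-assoc C (d * (e * e)) d′) ⟨
  C * (d * (e * e)) * d′ + n * d′
    ≤⟨ +-mono-≤ (*-monoˡ-≤ d′ n-large) (m≤m+n (n * d′) 0) ⟩
  2 * (n * d′)
    ≤⟨ *-monoʳ-≤ 2 nd′≤ ⟩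
  2 * (8 * x)
    ≡⟨ *-assoc 2 8 x ⟨
  16 * x ∎)
  where
  open ≤-Reasoning
  positive : 1 ≤ d * (e * e) * d′
  positive = *-mono-≤ (*-mono-≤ 1≤d (*-mono-≤ 1≤e 1≤e)) 1≤d′
  expand : ∀ e k m n s → 16 * ((m * (32 * e) + e * (2 * m)) * (35 * (e * k)) + n * s) ≡
    19040 * (e * e * (m * k)) + n * (s * 16)
  expand = solve-∀
  collect : ∀ c e d d′ → c * (e * e * (2 * d′ * (2 * d))) ≡ 4 * c * (d * (e * e) * d′)
  collect = solve-∀

m<[1+m/n]*n : ∀ m n → .{{_ : NonZero n}} → m < suc (m / n) * n
m<[1+m/n]*n m n = subst (_< suc (m / n) * n) (sym (m≡m%n+[m/n]*n m n)) (+-monoˡ-< (m / n * n) (m%n<n m n))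

-- Graphs that are large compared with d e²

count-unless : ∀ {n D} (p : Fin n → Bool) (D? : Dec (D ≤ count p)) →
  count (λ v → not (does D?) ∧ p v) ≤ D
count-unless {n} p (yes _) = ≤-trans (≤-reflexive (trans (sum-const n 0) (*-zeroʳ n))) z≤n
count-unless     p (no D≰) = <⇒≤ (≰⇒> D≰)

∧-exchange : ∀ a b {c d} → c ≡ d → a ∧ b ∧ c ≡ b ∧ a ∧ d
∧-exchange true  true  eq = eq
∧-exchange true  false eq = refl
∧-exchange false true  eq = refl
∧-exchange false false eq = refl

is-just-if : ∀ {A : Set} b {y : Maybe A} → is-just (if b then y else nothing) ≡ true → is-just y ≡ true
is-just-if true eq = eq

if-not : ∀ {A : Set} b {y : Maybe A} → not b ≡ true → (if b then y else nothing) ≡ nothing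
if-not false _ = refl

nothing-unless : ∀ {A : Set} (y : Maybe A) {b} → (is-just y ≡ true → b ≡ true) → not b ≡ true → y ≡ nothing
nothing-unless nothing          _ _ = refl
nothing-unless (just _) {false} h _ = contradiction (h refl) λ ()
nothing-unless (just _) {true}  _ ()

module LargeOrder {n} (adj : Fin n → Fin n → Bool)
  (adj-sym : ∀ u v → adj u v ≡ adj v u) (adj-irr : ∀ v → adj v v ≡ false)
  (d e : ℕ) (1≤d : 1 ≤ d) (1≤e : 1 ≤ e) (kk<2^e : (d + 1) * (d + 1) < 2 ^ e)
  (C : ℕ) (C-large : 76160 < C) (n-large : C * (d * (e * e)) ≤ n) (d≤deg : ∀ v → d ≤ count (adj v))
  (D : ℕ) (D≡ : D ≡ 35 * (e * (d + 1))) where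

  open ≤-Reasoning

  k : ℕ
  k = d + 1

  high low : Fin n → Bool
  high v = does (D ≤? count (adj v))
  low v = not (high v)

  -- A high vertex needs 2 e k neighbours that are still uncoloured; the other
  -- 33 e k make up for the centres and the spreading sets, coloured beforehand.
  D-bound : ∀ h m → h + m ≡ k → e * (2 * k) + (h + m * (32 * e)) ≤ D
  D-bound h m h+m≡k = begin
    e * (2 * k) + (h + m * (32 * e))
      ≤⟨ +-monoʳ-≤ (e * (2 * k)) (+-mono-≤ h≤ (*-monoˡ-≤ (32 * e) m≤)) ⟩
    e * (2 * k) + (e * k + k * (32 * e))
      ≡⟨ lemma e k ⟩
    35 * (e * k)
      ≡⟨ D≡ ⟨
    D ∎
    where
    m≤ : m ≤ k
    m≤ = ≤-trans (m≤n+m m h) (≤-reflexive h+m≡k)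
    h≤ : h ≤ e * k
    h≤ = ≤-trans (≤-trans (m≤m+n h m) (≤-reflexive (trans h+m≡k (sym (+-identityʳ k))))) (*-monoˡ-≤ k 1≤e)
    lemma : ∀ e k → e * (2 * k) + (e * k + k * (32 * e)) ≡ 35 * (e * k)
    lemma = solve-∀

  high-centre : ∀ h m → h + m ≡ k → ∀ u → high u ≡ true →
    e * (2 * (h + m)) + (h + m * (32 * e)) ≤ count (adj u)
  high-centre h m h+m≡k u hu = ≤-trans
    (≤-trans (≤-reflexive (cong (λ k → e * (2 * k) + (h + m * (32 * e))) h+m≡k)) (D-bound h m h+m≡k))
    (does⇒ (D ≤? count (adj u)) hu)

  -- With d centres a single colour is left. It is the largest, so the smaller colour of every pair
  -- is high, and the one low colour can take the empty set.
  many-high : d ≤ count high → Joined adj k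
  many-high d≤ with choose high d d≤
  ... | c , onto , c⊆high , c≤ =
    two-level-colouring adj d 1 e (1 * (32 * e)) kk<2^e c (λ _ → nothing) (λ _ _ → false)
      (λ i → let u , cu = onto i in
             u , cu , high-centre d 1 refl u (c⊆high u (cong is-just cu)))
      c≤ (≤-trans (≤-reflexive (trans (sum-const n 0) (*-zeroʳ n))) z≤n)
      (λ { zero zero () }) (λ _ _ ())

  -- `s` is d′ / 16 rounded down: `n * s` is at most a sixteenth of `n * d′`, while `32 * e`
  -- vertices with `suc s` new neighbours each still reach `e * (2 * m)` vertices.
  few-high : ∀ d′ s → count high + d′ ≡ d → 1 ≤ d′ → s * 16 ≤ d′ → d′ < suc s * 16 → Joined adj k
  few-high d′ s h+d′≡d 1≤d′ s≤ d′< = subst (Joined adj) h+m≡k coloured-low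
    where
    h m t T : ℕ
    h = count high
    m = suc d′
    t = 32 * e
    T = e * (2 * m)
    h+m≡k : h + m ≡ k
    h+m≡k = trans (+-suc h d′) (trans (cong suc h+d′≡d) (+-comm 1 d))
    E₀ : Fin n → Fin n → Bool
    E₀ u v = low u ∧ low v ∧ adj u v
    E₀-sym : ∀ u v → E₀ u v ≡ E₀ v u
    E₀-sym u v = ∧-exchange (low u) (low v) (adj-sym u v)
    E₀-irr : ∀ v → E₀ v v ≡ false
    E₀-irr v = trans (cong (λ b → low v ∧ low v ∧ b) (adj-irr v))
      (trans (cong (low v ∧_) (Bool.∧-zeroʳ (low v))) (Bool.∧-zeroʳ (low v)))

    degree-low : ∀ u → count (λ v → low u ∧ adj u v) ≤ D
    degree-low u = count-unless (adj u) (D ≤? count (adj u))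

    -- A low vertex loses at most its neighbours among the h high ones, which leaves d - h = d′. The
    -- last summand covers the high rows, which are empty in `E₀`.
    row-low : ∀ u → d′ ≤ count (E₀ u) + 𝟙 (high u) * d′
    row-low u with high u
    ... | true  = ≤-trans (≤-reflexive (sym (+-identityʳ d′))) (m≤n+m (d′ + 0) (count {n} (λ _ → false)))
    ... | false = +-cancelˡ-≤ h _ _ (begin
      h + d′                                    ≡⟨ h+d′≡d ⟩
      d                                         ≤⟨ d≤deg u ⟩
      count (adj u)                             ≤⟨ count-mono split ⟩
      count (λ v → high v ∨ low v ∧ adj u v)    ≤⟨ count-∨-≤ high (λ v → low v ∧ adj u v) ⟩
      h + count (λ v → low v ∧ adj u v)         ≤⟨ +-monoʳ-≤ h (m≤m+n _ 0) ⟩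
      h + (count (λ v → low v ∧ adj u v) + 0)   ∎)
      where
      split : ∀ v → adj u v ≡ true → high v ∨ low v ∧ adj u v ≡ true
      split v uv with high v
      ... | true  = refl
      ... | false = uv
    2d≤n : d + d ≤ n
    2d≤n = begin
      d + d                  ≡⟨ cong (d +_) (+-identityʳ d) ⟨
      2 * d                  ≤⟨ *-monoʳ-≤ 2 d≤dee ⟩
      2 * (d * (e * e))      ≤⟨ *-monoˡ-≤ (d * (e * e)) (≤-<-trans (s≤s z≤n) C-large) ⟩
      C * (d * (e * e))      ≤⟨ n-large ⟩
      n                      ∎
      where
      d≤dee : d ≤ d * (e * e)
      d≤dee = ≤-trans (≤-reflexive (sym (*-identityʳ d))) (*-monoʳ-≤ d (*-mono-≤ 1≤e 1≤e))
    -- The high rows cost h * d′, and 2 h ≤ 2 d ≤ n, so at least half of n * d′ remains.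
    E₀-many : n * d′ ≤ 2 * edges E₀
    E₀-many = +-cancelʳ-≤ (n * d′) _ _ (begin
      n * d′ + n * d′               ≤⟨ +-mono-≤ once once ⟩
      (edges E₀ + h * d′) + (edges E₀ + h * d′) ≡⟨ lemma (edges E₀) h d′ ⟩
      2 * edges E₀ + (h + h) * d′   ≤⟨ +-monoʳ-≤ (2 * edges E₀) (*-monoˡ-≤ d′ (≤-trans (+-mono-≤ h≤d h≤d) 2d≤n)) ⟩
      2 * edges E₀ + n * d′         ∎)
      where
      h≤d : h ≤ d
      h≤d = ≤-trans (m≤m+n h d′) (≤-reflexive h+d′≡d)
      lemma : ∀ x h d → (x + h * d) + (x + h * d) ≡ 2 * x + (h + h) * d
      lemma = solve-∀
      once : n * d′ ≤ edges E₀ + h * d′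
      once = begin
        n * d′                                            ≡⟨ sum-const n d′ ⟨
        sum {n} (λ _ → d′)                                ≤⟨ sum-mono row-low ⟩
        sum (λ u → count (E₀ u) + 𝟙 (high u) * d′)        ≡⟨ ∑-distrib-+ (λ u → count (E₀ u)) _ ⟩
        edges E₀ + sum (λ u → 𝟙 (high u) * d′)            ≡⟨ cong (edges E₀ +_) (*-distribʳ-sum d′ (𝟙 ∘ high)) ⟨
        edges E₀ + h * d′                                 ∎
    m≤2d′ : m ≤ 2 * d′
    m≤2d′ = ≤-trans (+-monoˡ-≤ d′ 1≤d′) (≤-reflexive (cong (d′ +_) (sym (+-identityʳ d′))))
    k≤2d : k ≤ 2 * d
    k≤2d = ≤-trans (+-monoʳ-≤ d 1≤d) (≤-reflexive (cong (d +_) (sym (+-identityʳ d))))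
    T≤ : T ≤ t * suc s
    T≤ = begin
      e * (2 * m)              ≤⟨ *-monoʳ-≤ e (*-monoʳ-≤ 2 d′<) ⟩
      e * (2 * (suc s * 16))   ≡⟨ lemma e (suc s) ⟩
      32 * e * suc s           ∎
      where
      lemma : ∀ e s → e * (2 * (s * 16)) ≡ 32 * e * s
      lemma = solve-∀

    module _ (X : Fin n → Bool) (X-cuts : edges E₀ ≤ 4 * edges (λ u v → X u ∧ not (X v) ∧ E₀ u v)) where

      E : Fin n → Fin n → Bool
      E u v = X u ∧ not (X v) ∧ E₀ u v
      E⇒ : ∀ u v → E u v ≡ true → X u ≡ true × not (X v) ≡ true × low u ≡ true × low v ≡ true × adj u v ≡ true
      E⇒ u v uv =
        let uv₁ = ∧-trueʳ {X u} uv
            uv₂ = ∧-trueʳ {not (X v)} uv₁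
            uv₃ = ∧-trueʳ {low u} uv₂
        in ∧-trueˡ uv , ∧-trueˡ uv₁ , ∧-trueˡ uv₂ , ∧-trueˡ uv₃ , ∧-trueʳ {low v} uv₃
      row≤ : ∀ u → count (E u) ≤ D
      row≤ u = ≤-trans (count-mono (λ v uv → let _ , _ , lu , _ , a = E⇒ u v uv in cong₂ _∧_ lu a)) (degree-low u)
      column≤ : ∀ v → count (λ u → E u v) ≤ D
      column≤ v = ≤-trans
        (count-mono (λ u uv → let _ , _ , _ , lv , a = E⇒ u v uv in cong₂ _∧_ lv (trans (adj-sym v u) a)))
        (degree-low v)

      E-many : n * d′ ≤ 8 * edges E
      E-many = begin
        n * d′              ≤⟨ E₀-many ⟩
        2 * edges E₀        ≤⟨ *-monoʳ-≤ 2 X-cuts ⟩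
        2 * (4 * edges E)   ≡⟨ *-assoc 2 4 (edges E) ⟨
        8 * edges E         ∎
      E-room : (m * t + T) * D + n * s < edges E
      E-room = room {C} {D} {e} {d} {d′} {k} {m} {n} {s} D≡ E-many C-large n-large 1≤d 1≤e 1≤d′ k≤2d m≤2d′ s≤

      module _ (a : Fin n → Maybe (Fin m)) (S : Fin m → Fin n → Bool)
        (a≤ : count (is-just ∘ a) ≤ m * t) (S-large : ∀ i → T ≤ count (S i))
        (S-near : ∀ i v → S i v ≡ true → ∃ λ u → a u ≡ just i × E u v ≡ true)
        (c : Fin n → Maybe (Fin h)) (c-onto : ∀ i → ∃ λ u → c u ≡ just i)
        (c⊆high : ∀ u → is-just (c u) ≡ true → high u ≡ true) (c≤ : count (is-just ∘ c) ≤ h) where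

        -- The restriction to `X` leaves the other side of the cut, where every `S i` lies, free of
        -- low colours. The edges of `E` start in `X`, so each vertex of `S i` keeps its neighbour
        -- of colour i.
        b : Fin n → Maybe (Fin m)
        b u = if X u then a u else nothing

        coloured : Joined adj (h + m)
        coloured = two-level-colouring adj h m e (m * t)
          (subst (λ k → k * k < 2 ^ e) (sym h+m≡k) kk<2^e) c b S
          (λ i → let u , cu = c-onto i in u , cu , high-centre h m h+m≡k u (c⊆high u (cong is-just cu)))
          c≤ (≤-trans (count-mono (λ u → is-just-if (X u))) a≤) (λ i _ _ → S-large i)
          (λ i v Sv →
            let u , au , uv = S-near i v Sv
                Xu , ¬Xv , lu , lv , adj-uv = E⇒ u v uv
            in nothing-unless (c v) (c⊆high v) lv , if-not (X v) ¬Xv ,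
               u , nothing-unless (c u) (c⊆high u) lu ,
               trans (cong (if_then a u else nothing) Xu) au , adj-uv)

    coloured-low : Joined adj (h + m)
    coloured-low =
      let X , X-cuts = directed-cut E₀ E₀-sym E₀-irr
          a , S , a≤ , S-large , S-near = BoundedDegree.spreading-family (E X X-cuts) D
            (row≤ X X-cuts) (column≤ X X-cuts) T s t m T≤ (E-room X X-cuts)
          c , c-onto , c⊆high , c≤ = choose high h ≤-refl
      in coloured X X-cuts a S a≤ S-large S-near c c-onto c⊆high c≤

  joined-colouring : Joined adj k
  joined-colouring with d ≤? count high
  ... | yes d≤ = many-high d≤
  ... | no  d≰ = let d₀ , eq = m≤n⇒∃[o]m+o≡n (≰⇒> d≰) in
    few-high (suc d₀) (suc d₀ / 16) (trans (+-suc (count high) d₀) eq) (s≤s z≤n)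
      (m/n*n≤m (suc d₀) 16) (m<[1+m/n]*n (suc d₀) 16)

-- The logarithm

-- A binomial coefficient is at most 2 ^ (a + b), stated without division; the induction is Pascal's
-- rule.
[a+b]!≤ : ∀ a b → (a + b) ! ≤ 2 ^ (a + b) * (a ! * b !)
[a+b]!≤ zero b = ≤-trans (m≤n*m (b !) (2 ^ b) {{m^n≢0 2 b}}) (≤-reflexive (cong (2 ^ b *_) (sym (+-identityʳ (b !)))))
[a+b]!≤ (suc a) zero = subst (λ m → m ! ≤ 2 ^ m * (suc a ! * 1)) (sym (+-identityʳ (suc a)))
  (≤-trans (m≤n*m (suc a !) (2 ^ suc a) {{m^n≢0 2 (suc a)}})
    (≤-reflexive (cong (2 ^ suc a *_) (sym (*-identityʳ (suc a !))))))
[a+b]!≤ (suc a) (suc b) = begin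
  (suc a + suc b) * N !                              ≡⟨ *-distribʳ-+ (N !) (suc a) (suc b) ⟩
  suc a * N ! + suc b * N !                          ≤⟨ +-mono-≤ (*-monoʳ-≤ (suc a) ([a+b]!≤ a (suc b)))
                                                          (*-monoʳ-≤ (suc b) right) ⟩
  suc a * (2 ^ N * (a ! * suc b !)) + suc b * (2 ^ N * (suc a ! * b !)) ≡⟨ lemma (suc a) (suc b) (2 ^ N) (a !) (b !) ⟩
  2 ^ (suc a + suc b) * (suc a ! * suc b !)          ∎
  where
  open ≤-Reasoning
  N = a + suc b
  right : N ! ≤ 2 ^ N * (suc a ! * b !)
  right = subst (λ N → N ! ≤ 2 ^ N * (suc a ! * b !)) (sym (+-suc a b)) ([a+b]!≤ (suc a) b)
  lemma : ∀ x y p f g → x * (p * (f * (y * g))) + y * (p * ((x * f) * g)) ≡ 2 * p * ((x * f) * (y * g))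
  lemma = solve-∀

m^k*m!≤[m+k]! : ∀ m k → m ^ k * m ! ≤ (m + k) !
m^k*m!≤[m+k]! m zero    = ≤-reflexive (trans (+-identityʳ (m !)) (cong _! (sym (+-identityʳ m))))
m^k*m!≤[m+k]! m (suc k) = begin
  m * m ^ k * m !          ≡⟨ *-assoc m (m ^ k) (m !) ⟩
  m * (m ^ k * m !)        ≤⟨ *-mono-≤ (m≤n⇒m≤1+n (m≤m+n m k)) (m^k*m!≤[m+k]! m k) ⟩
  suc (m + k) * (m + k) !  ≡⟨ cong _! (+-suc m k) ⟨
  (m + suc k) !            ∎
  where open ≤-Reasoning

-- A substitute for m ^ k / k! ≤ exp m: compare m ^ k with (m + k)! / m! and bound the binomial
-- coefficient.
m^k≤2^[m+k]*k! : ∀ m k → m ^ k ≤ 2 ^ (m + k) * k !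
m^k≤2^[m+k]*k! m k = *-cancelʳ-≤ _ _ (m !) {{m !≢0}} (begin
  m ^ k * m !                  ≤⟨ m^k*m!≤[m+k]! m k ⟩
  (m + k) !                    ≤⟨ [a+b]!≤ m k ⟩
  2 ^ (m + k) * (m ! * k !)    ≡⟨ lemma (2 ^ (m + k)) (m !) (k !) ⟩
  2 ^ (m + k) * k ! * m !      ∎)
  where
  open ≤-Reasoning
  lemma : ∀ p f g → p * (f * g) ≡ p * g * f
  lemma = solve-∀

^-distribʳ-* : ∀ k m n → (m * n) ^ k ≡ m ^ k * n ^ k
^-distribʳ-* zero    m n = refl
^-distribʳ-* (suc k) m n = trans (cong (m * n *_) (^-distribʳ-* k m n)) (lemma m n (m ^ k) (n ^ k))
  where
  lemma : ∀ m n p q → m * n * (p * q) ≡ m * p * (n * q)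
  lemma = solve-∀

-- Taking m = 4 ℓ in the previous bound puts 4 ^ k against 2 ^ k, so the exponential terms ℓ ^ k /
-- k! decay like 16 ^ ℓ / 2 ^ k and can be summed as a geometric series.
ℓ^k*2^k≤16^ℓ*k! : ∀ ℓ k → ℓ ^ k * 2 ^ k ≤ 16 ^ ℓ * k !
ℓ^k*2^k≤16^ℓ*k! ℓ k = *-cancelʳ-≤ _ _ (2 ^ k) {{m^n≢0 2 k}} (begin
  ℓ ^ k * 2 ^ k * 2 ^ k        ≡⟨ *-assoc (ℓ ^ k) (2 ^ k) (2 ^ k) ⟩
  ℓ ^ k * (2 ^ k * 2 ^ k)      ≡⟨ cong (ℓ ^ k *_) (^-distribʳ-* k 2 2) ⟨
  ℓ ^ k * 4 ^ k                ≡⟨ ^-distribʳ-* k ℓ 4 ⟨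
  (ℓ * 4) ^ k                  ≡⟨ cong (_^ k) (*-comm ℓ 4) ⟩
  (4 * ℓ) ^ k                  ≤⟨ m^k≤2^[m+k]*k! (4 * ℓ) k ⟩
  2 ^ (4 * ℓ + k) * k !        ≡⟨ cong (_* k !) (^-distribˡ-+-* 2 (4 * ℓ) k) ⟩
  2 ^ (4 * ℓ) * 2 ^ k * k !    ≡⟨ cong (λ p → p * 2 ^ k * k !) (^-*-assoc 2 4 ℓ) ⟨
  16 ^ ℓ * 2 ^ k * k !         ≡⟨ lemma (16 ^ ℓ) (2 ^ k) (k !) ⟩
  16 ^ ℓ * k ! * 2 ^ k         ∎)
  where
  open ≤-Reasoning
  lemma : ∀ p q f → p * q * f ≡ p * f * q
  lemma = solve-∀

-- Natural numbers as rationals and the exponential sums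

toℚᵘ-fromℕ : ∀ n → toℚᵘ (fromℕ n) ℚᵘ.≃ mkℚᵘ (ℤ.+ n) 0
toℚᵘ-fromℕ n = ℚ.toℚᵘ-fromℚᵘ (mkℚᵘ (ℤ.+ n) 0)

fromℕ-* : ∀ m n → fromℕ (m * n) ≡ fromℕ m ℚ.* fromℕ n
fromℕ-* m n = ℚ.toℚᵘ-injective (begin-equality
  toℚᵘ (fromℕ (m * n))                   ≃⟨ toℚᵘ-fromℕ (m * n) ⟩
  mkℚᵘ (ℤ.+ (m * n)) 0                     ≃⟨ *≡* (cong (ℤ._* ℤ.+ 1) (ℤ.pos-* m n)) ⟩
  mkℚᵘ (ℤ.+ m) 0 ℚᵘ.* mkℚᵘ (ℤ.+ n) 0         ≃⟨ ℚᵘ.*-cong (toℚᵘ-fromℕ m) (toℚᵘ-fromℕ n) ⟨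
  toℚᵘ (fromℕ m) ℚᵘ.* toℚᵘ (fromℕ n)     ≃⟨ ℚ.toℚᵘ-homo-* (fromℕ m) (fromℕ n) ⟨
  toℚᵘ (fromℕ m ℚ.* fromℕ n)             ∎)
  where open ℚᵘ.≤-Reasoning

fromℕ-mono-≤ : ∀ {m n} → m ≤ n → fromℕ m ℚ.≤ fromℕ n
fromℕ-mono-≤ {m} {n} m≤n = ℚ.toℚᵘ-cancel-≤ (begin
  toℚᵘ (fromℕ m)  ≃⟨ toℚᵘ-fromℕ m ⟩
  mkℚᵘ (ℤ.+ m) 0    ≤⟨ *≤* (ℤ.*-monoʳ-≤-nonNeg (ℤ.+ 1) (ℤ.+≤+ m≤n)) ⟩
  mkℚᵘ (ℤ.+ n) 0    ≃⟨ toℚᵘ-fromℕ n ⟨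
  toℚᵘ (fromℕ n)  ∎)
  where open ℚᵘ.≤-Reasoning

fromℕ-cancel-≤ : ∀ {m n} → fromℕ m ℚ.≤ fromℕ n → m ≤ n
fromℕ-cancel-≤ {m} {n} le = cancel (begin
  mkℚᵘ (ℤ.+ m) 0    ≃⟨ toℚᵘ-fromℕ m ⟨
  toℚᵘ (fromℕ m)  ≤⟨ ℚ.toℚᵘ-mono-≤ le ⟩
  toℚᵘ (fromℕ n)  ≃⟨ toℚᵘ-fromℕ n ⟩
  mkℚᵘ (ℤ.+ n) 0    ∎)
  where
  open ℚᵘ.≤-Reasoning
  cancel : mkℚᵘ (ℤ.+ m) 0 ℚᵘ.≤ mkℚᵘ (ℤ.+ n) 0 → m ≤ n
  cancel (*≤* le) = ℤ.drop‿+≤+ (subst₂ ℤ._≤_ (ℤ.*-identityʳ (ℤ.+ m)) (ℤ.*-identityʳ (ℤ.+ n)) le)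

fromℕ-positive : ∀ n → .{{NonZero n}} → ℚ.Positive (fromℕ n)
fromℕ-positive n = ℚ.normalize-pos n 1

fromℕ-nonNegative : ∀ n → ℚ.NonNegative (fromℕ n)
fromℕ-nonNegative n = ℚ.normalize-nonNeg n 1

1/n*n≡1 : ∀ n → .{{_ : NonZero n}} → (1ℤ ℚ./ n) ℚ.* fromℕ n ≡ 1ℚ
1/n*n≡1 n@(suc n-1) = ℚ.toℚᵘ-injective (begin-equality
  toℚᵘ ((1ℤ ℚ./ n) ℚ.* fromℕ n)           ≃⟨ ℚ.toℚᵘ-homo-* (1ℤ ℚ./ n) (fromℕ n) ⟩
  toℚᵘ (1ℤ ℚ./ n) ℚᵘ.* toℚᵘ (fromℕ n)     ≃⟨ ℚᵘ.*-cong (ℚ.toℚᵘ-fromℚᵘ (mkℚᵘ 1ℤ n-1)) (toℚᵘ-fromℕ n) ⟩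
  mkℚᵘ 1ℤ n-1 ℚᵘ.* mkℚᵘ (ℤ.+ n) 0           ≃⟨ *≡* (trans (ℤ.*-identityʳ _) (cong ℤ.+_ lemma)) ⟩
  mkℚᵘ 1ℤ 0                               ≡⟨⟩
  toℚᵘ 1ℚ                                 ∎)
  where
  open ℚᵘ.≤-Reasoning
  lemma : n + 0 ≡ n * 1 + 0
  lemma = trans (+-identityʳ n) (sym (trans (+-identityʳ (n * 1)) (*-identityʳ n)))

fromℕ-^ : ∀ m k → fromℕ m ^ℚ k ≡ fromℕ (m ^ k)
fromℕ-^ m zero    = refl
fromℕ-^ m (suc k) = trans (cong (fromℕ m ℚ.*_) (fromℕ-^ m k)) (sym (fromℕ-* m (m ^ k)))

expTerm≤ : ∀ ℓ k → ((fromℕ ℓ ^ℚ k) ℚ.* (1ℤ ℚ./ (k !)) {{k !≢0}}) ℚ.* fromℕ (2 ^ k) ℚ.≤ fromℕ (16 ^ ℓ)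
expTerm≤ ℓ k = ℚ.*-cancelʳ-≤-pos (fromℕ (k !)) {{fromℕ-positive (k !) {{k !≢0}}}} (begin
  fromℕ ℓ ^ℚ k ℚ.* i ℚ.* fromℕ (2 ^ k) ℚ.* fromℕ (k !)
    ≡⟨ cong (λ p → p ℚ.* i ℚ.* fromℕ (2 ^ k) ℚ.* fromℕ (k !)) (fromℕ-^ ℓ k) ⟩
  fromℕ (ℓ ^ k) ℚ.* i ℚ.* fromℕ (2 ^ k) ℚ.* fromℕ (k !)
    ≡⟨ lemma (fromℕ (ℓ ^ k)) i (fromℕ (2 ^ k)) (fromℕ (k !)) ⟩
  fromℕ (ℓ ^ k) ℚ.* fromℕ (2 ^ k) ℚ.* (i ℚ.* fromℕ (k !))
    ≡⟨ cong (fromℕ (ℓ ^ k) ℚ.* fromℕ (2 ^ k) ℚ.*_) (1/n*n≡1 (k !) {{k !≢0}}) ⟩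
  fromℕ (ℓ ^ k) ℚ.* fromℕ (2 ^ k) ℚ.* 1ℚ
    ≡⟨ ℚ.*-identityʳ _ ⟩
  fromℕ (ℓ ^ k) ℚ.* fromℕ (2 ^ k)
    ≡⟨ fromℕ-* (ℓ ^ k) (2 ^ k) ⟨
  fromℕ (ℓ ^ k * 2 ^ k)
    ≤⟨ fromℕ-mono-≤ (ℓ^k*2^k≤16^ℓ*k! ℓ k) ⟩
  fromℕ (16 ^ ℓ * k !)
    ≡⟨ fromℕ-* (16 ^ ℓ) (k !) ⟩
  fromℕ (16 ^ ℓ) ℚ.* fromℕ (k !) ∎)
  where
  open ℚ.≤-Reasoning
  i = (1ℤ ℚ./ (k !)) {{k !≢0}}
  lemma : ∀ p i t f → p ℚ.* i ℚ.* t ℚ.* f ≡ p ℚ.* t ℚ.* (i ℚ.* f)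
  lemma = solve 4 (λ p i t f → p :* i :* t :* f := p :* t :* (i :* f)) refl
    where open +-*-Solver

-- Each term is at most 16 ^ ℓ / 2 ^ k, so expSum K ≤ 2 * 16 ^ ℓ * (1 - 1 / 2 ^ K).
expSum-invariant : ∀ ℓ K → expSum (fromℕ ℓ) K ℚ.* fromℕ (2 ^ K) ℚ.+ fromℕ (2 * 16 ^ ℓ) ℚ.≤
                           fromℕ (2 * 16 ^ ℓ) ℚ.* fromℕ (2 ^ K)
expSum-invariant ℓ zero = ℚ.≤-reflexive (trans (cong (ℚ._+ b) (ℚ.*-zeroˡ (fromℕ 1)))
  (trans (ℚ.+-identityˡ b) (sym (ℚ.*-identityʳ b))))
  where b = fromℕ (2 * 16 ^ ℓ)
expSum-invariant ℓ (suc K) = begin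
  (s ℚ.+ x) ℚ.* fromℕ (2 * 2 ^ K) ℚ.+ b
    ≡⟨ cong (λ p → (s ℚ.+ x) ℚ.* p ℚ.+ b) (fromℕ-* 2 (2 ^ K)) ⟩
  (s ℚ.+ x) ℚ.* (two ℚ.* p) ℚ.+ b
    ≡⟨ lemma₁ s x two p b ⟩
  two ℚ.* (s ℚ.* p) ℚ.+ two ℚ.* (x ℚ.* p) ℚ.+ b
    ≤⟨ ℚ.+-monoˡ-≤ b (ℚ.+-monoʳ-≤ (two ℚ.* (s ℚ.* p)) (ℚ.*-monoˡ-≤-nonNeg two (expTerm≤ ℓ K))) ⟩
  two ℚ.* (s ℚ.* p) ℚ.+ two ℚ.* fromℕ (16 ^ ℓ) ℚ.+ b
    ≡⟨ cong (λ y → two ℚ.* (s ℚ.* p) ℚ.+ y ℚ.+ b) (fromℕ-* 2 (16 ^ ℓ)) ⟨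
  two ℚ.* (s ℚ.* p) ℚ.+ b ℚ.+ b
    ≡⟨ lemma₂ (s ℚ.* p) b ⟩
  two ℚ.* (s ℚ.* p ℚ.+ b)
    ≤⟨ ℚ.*-monoˡ-≤-nonNeg two (expSum-invariant ℓ K) ⟩
  two ℚ.* (b ℚ.* p)
    ≡⟨ lemma₃ two b p ⟩
  b ℚ.* (two ℚ.* p)
    ≡⟨ cong (b ℚ.*_) (fromℕ-* 2 (2 ^ K)) ⟨
  b ℚ.* fromℕ (2 * 2 ^ K) ∎
  where
  open ℚ.≤-Reasoning
  s = expSum (fromℕ ℓ) K
  x = (fromℕ ℓ ^ℚ K) ℚ.* (1ℤ ℚ./ (K !)) {{K !≢0}}
  b = fromℕ (2 * 16 ^ ℓ)
  p = fromℕ (2 ^ K)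
  two = fromℕ 2
  open +-*-Solver
  lemma₁ : ∀ s x t p b → (s ℚ.+ x) ℚ.* (t ℚ.* p) ℚ.+ b ≡ t ℚ.* (s ℚ.* p) ℚ.+ t ℚ.* (x ℚ.* p) ℚ.+ b
  lemma₁ = solve 5 (λ s x t p b → (s :+ x) :* (t :* p) :+ b := t :* (s :* p) :+ t :* (x :* p) :+ b) refl
  lemma₂ : ∀ y b → two ℚ.* y ℚ.+ b ℚ.+ b ≡ two ℚ.* (y ℚ.+ b)
  lemma₂ = solve 2 (λ y b → con two :* y :+ b :+ b := con two :* (y :+ b)) refl
  lemma₃ : ∀ t b p → t ℚ.* (b ℚ.* p) ≡ b ℚ.* (t ℚ.* p)
  lemma₃ = solve 3 (λ t b p → t :* (b :* p) := b :* (t :* p)) refl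

-- Rests on exp ℓ ≤ 2 * 16 ^ ℓ. The crude base costs only a constant factor in the logarithm.
2*16^ℓ≤n⇒ℓ≤log : ∀ ℓ n → 2 * 16 ^ ℓ ≤ n → fromℕ ℓ ≤log n
2*16^ℓ≤n⇒ℓ≤log ℓ n le = record
  { nonNegative = ℚ.nonNegative⁻¹ (fromℕ ℓ) {{fromℕ-nonNegative ℓ}}
  ; exp≤        = λ K → ℚ.≤-trans
      (ℚ.*-cancelʳ-≤-pos (fromℕ (2 ^ K)) {{fromℕ-positive (2 ^ K) {{m^n≢0 2 K}}}} (below K))
      (fromℕ-mono-≤ le)
  }
  where
  open ℚ.≤-Reasoning
  b = fromℕ (2 * 16 ^ ℓ)
  below : ∀ K → expSum (fromℕ ℓ) K ℚ.* fromℕ (2 ^ K) ℚ.≤ b ℚ.* fromℕ (2 ^ K)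
  below K = begin
    y          ≡⟨ ℚ.+-identityʳ y ⟨
    y ℚ.+ 0ℚ   ≤⟨ ℚ.+-monoʳ-≤ y (ℚ.nonNegative⁻¹ b {{fromℕ-nonNegative (2 * 16 ^ ℓ)}}) ⟩
    y ℚ.+ b    ≤⟨ expSum-invariant ℓ K ⟩
    b ℚ.* fromℕ (2 ^ K) ∎
    where y = expSum (fromℕ ℓ) K ℚ.* fromℕ (2 ^ K)

-- The hypothesis on log² n is applied to the single rational q = ℓ, which turns it into an
-- inequality between natural numbers.
log²-bound : ∀ C .{{_ : NonZero C}} {d n} ℓ → 2 * 16 ^ ℓ ≤ n →
  d ≤ 1ℤ ℚ./ C · n /log² n → C * (d * (ℓ * ℓ)) ≤ n
log²-bound C {d} {n} ℓ le bound = fromℕ-cancel-≤ (begin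
  fromℕ (C * (d * (ℓ * ℓ)))                        ≡⟨ fromℕ-* C (d * (ℓ * ℓ)) ⟩
  fromℕ C ℚ.* fromℕ (d * (ℓ * ℓ))                  ≡⟨ cong (fromℕ C ℚ.*_) square ⟩
  fromℕ C ℚ.* (fromℕ d ℚ.* fromℕ ℓ ^ℚ 2)           ≤⟨ ℚ.*-monoˡ-≤-nonNeg (fromℕ C) {{fromℕ-nonNegative C}}
                                                        (bound (fromℕ ℓ) (2*16^ℓ≤n⇒ℓ≤log ℓ n le)) ⟩
  fromℕ C ℚ.* ((1ℤ ℚ./ C) ℚ.* fromℕ n)             ≡⟨ lemma (fromℕ C) (1ℤ ℚ./ C) (fromℕ n) ⟩
  (1ℤ ℚ./ C) ℚ.* fromℕ C ℚ.* fromℕ n               ≡⟨ cong (ℚ._* fromℕ n) (1/n*n≡1 C) ⟩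
  1ℚ ℚ.* fromℕ n                                   ≡⟨ ℚ.*-identityˡ (fromℕ n) ⟩
  fromℕ n                                          ∎)
  where
  open ℚ.≤-Reasoning
  square : fromℕ (d * (ℓ * ℓ)) ≡ fromℕ d ℚ.* fromℕ ℓ ^ℚ 2
  square = trans (cong (λ x → fromℕ (d * (ℓ * x))) (sym (*-identityʳ ℓ)))
    (trans (fromℕ-* d (ℓ ^ 2)) (cong (fromℕ d ℚ.*_) (sym (fromℕ-^ ℓ 2))))
  lemma : ∀ c i n → c ℚ.* (i ℚ.* n) ≡ i ℚ.* c ℚ.* n
  lemma = solve 3 (λ c i n → c :* (i :* n) := i :* c :* n) refl
    where open +-*-Solver

-- An integer logarithm

n<2*16^[1+n] : ∀ n → n < 2 * 16 ^ suc n
n<2*16^[1+n] zero    = s≤s z≤n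
n<2*16^[1+n] (suc n) = begin-strict
  1 + n                          <⟨ +-mono-≤-< (≤-<-trans {j = n} z≤n (n<2*16^[1+n] n)) (n<2*16^[1+n] n) ⟩
  2 * 16 ^ suc n + 2 * 16 ^ suc n ≡⟨ lemma (16 ^ suc n) ⟩
  4 * 16 ^ suc n                 ≤⟨ *-monoˡ-≤ (16 ^ suc n) (m≤m+n 4 28) ⟩
  32 * 16 ^ suc n                ≡⟨ *-assoc 2 16 (16 ^ suc n) ⟩
  2 * 16 ^ suc (suc n)           ∎
  where
  open ≤-Reasoning
  lemma : ∀ x → 2 * x + 2 * x ≡ 4 * x
  lemma = solve-∀

-- A downward search for the largest ℓ with 2 * 16 ^ ℓ ≤ n; since 32 = 2 * 16, it stops at ℓ = 1 at
-- the latest.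
discrete-log : ∀ n → 32 ≤ n → ∃ λ ℓ → 1 ≤ ℓ × 2 * 16 ^ ℓ ≤ n × n < 2 * 16 ^ suc ℓ
discrete-log n 32≤n = search n (n<2*16^[1+n] n)
  where
  search : ∀ ℓ → n < 2 * 16 ^ suc ℓ → ∃ λ ℓ → 1 ≤ ℓ × 2 * 16 ^ ℓ ≤ n × n < 2 * 16 ^ suc ℓ
  search zero    n< = contradiction 32≤n (<⇒≱ n<)
  search (suc ℓ) n< with 2 * 16 ^ suc ℓ ≤? n
  ... | yes le = suc ℓ , s≤s z≤n , le , n<
  ... | no  ≰n = search ℓ (≰⇒> ≰n)

-- Here n < 2 ^ (4 ℓ + 5), so n * n < 2 ^ (8 ℓ + 10), and 10 ≤ 10 ℓ. This is the source of the
-- choice e = 18 ℓ.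
n*n<2^[18*ℓ] : ∀ {n ℓ} → 1 ≤ ℓ → n < 2 * 16 ^ suc ℓ → n * n < 2 ^ (18 * ℓ)
n*n<2^[18*ℓ] {n} {ℓ} 1≤ℓ n< = begin-strict
  n * n                                      <⟨ *-mono-< n<2^x n<2^x ⟩
  2 ^ (1 + 4 * suc ℓ) * 2 ^ (1 + 4 * suc ℓ)  ≡⟨ ^-distribˡ-+-* 2 (1 + 4 * suc ℓ) _ ⟨
  2 ^ ((1 + 4 * suc ℓ) + (1 + 4 * suc ℓ))    ≡⟨ cong (2 ^_) (lemma ℓ) ⟩
  2 ^ (8 * ℓ + 10 * 1)                       ≤⟨ ^-monoʳ-≤ 2 (+-monoʳ-≤ (8 * ℓ) (*-monoʳ-≤ 10 1≤ℓ)) ⟩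
  2 ^ (8 * ℓ + 10 * ℓ)                       ≡⟨ cong (2 ^_) (*-distribʳ-+ ℓ 8 10) ⟨
  2 ^ (18 * ℓ)                               ∎
  where
  open ≤-Reasoning
  n<2^x : n < 2 ^ (1 + 4 * suc ℓ)
  n<2^x = subst (n <_) (cong (2 *_) (^-*-assoc 2 4 (suc ℓ))) n<
  lemma : ∀ ℓ → (1 + 4 * suc ℓ) + (1 + 4 * suc ℓ) ≡ 8 * ℓ + 10 * 1
  lemma = solve-∀

-- The pseudoachromatic number

length-filter-tabulate : ∀ {n} {A : Set} {P : A → Set} (P? : ∀ x → Dec (P x)) (f : Fin n → A) →
  length (filter P? (tabulate f)) ≡ count (λ i → does (P? (f i)))
length-filter-tabulate {zero}  P? f = refl
length-filter-tabulate {suc n} P? f with does (P? (f zero))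
... | true  = cong suc (length-filter-tabulate P? (f ∘ suc))
... | false = length-filter-tabulate P? (f ∘ suc)

module _ {n} (G : Graph n) where
  open Graph G

  adjacent : Fin n → Fin n → Bool
  adjacent u v = does (u ~? v)

  adjacent-sym : ∀ u v → adjacent u v ≡ adjacent v u
  adjacent-sym u v with u ~? v
  ... | yes uv = sym (dec-true (v ~? u) (~-sym uv))
  ... | no ¬uv = sym (dec-false (v ~? u) (¬uv ∘ ~-sym))

  adjacent-irrefl : ∀ v → adjacent v v ≡ false
  adjacent-irrefl v = dec-false (v ~? v) (~-irrefl refl)

  δ≤degree : ∀ v → δ ≤ count (adjacent v)
  δ≤degree v = ≤-trans
    (All.lookup (min≤xs n _) (∈-map⁺ degree (∈-allFin v)))
    (≤-reflexive (length-filter-tabulate (v ~?_) id))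

  -- As there are at least two colours, every colour lies on an edge to another one,
  -- `punchIn i zero`, and so occurs. The pairs with j < i follow by symmetry of adjacency.
  pseudocomplete : ∀ {k} → 2 ≤ k → Joined adjacent k → PseudocompleteColouring G k
  pseudocomplete {suc zero}    (s≤s ())
  pseudocomplete {suc (suc k)} _ (f , joined) = f , record
    { surjective = λ i →
        let u , _ , _ , fu , _ = connected i (punchIn i zero) (Fin.punchInᵢ≢i i zero ∘ sym) in u , fu
    ; connected  = connected }
    where
    connected : ∀ i j → i ≢ j → ∃ λ u → ∃ λ v → u ~ v × f u ≡ i × f v ≡ j
    connected i j i≢j with Fin.<-cmp i j
    ... | tri≈ _ i≡j _ = contradiction i≡j i≢j
    ... | tri< i<j _ _ = let u , v , uv , fu , fv = joined i j i<j in u , v , does⇒ (u ~? v) uv , fu , fv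
    ... | tri> _ _ j<i = let u , v , uv , fu , fv = joined j i j<i in v , u , ~-sym (does⇒ (u ~? v) uv) , fv , fu

module _ (C : ℕ) (C-large : 76160 < C) where

  -- Take e = 18 ℓ with ℓ the integer logarithm; 324 = 18 * 18 absorbs the square. The bound on d
  -- gives d + 1 ≤ n, hence (d + 1) ^ 2 ≤ n * n < 2 ^ e.
  d+1≤ψₛ : .{{_ : NonZero (C * 324)}} →
    ∀ n d → 32 ≤ n → 1 ≤ d → d ≤ 1ℤ ℚ./ (C * 324) · n /log² n →
    ∀ (G : Graph n) → d ≤ Graph.δ G → d + 1 ≤ ψₛ G
  d+1≤ψₛ n d 32≤n 1≤d d-small G d≤δ with discrete-log n 32≤n
  ... | ℓ , 1≤ℓ , ≤n , n< = ψₛ-maximum G (pseudocomplete G 2≤d+1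
    (LargeOrder.joined-colouring (adjacent G) (adjacent-sym G) (adjacent-irrefl G) d (18 * ℓ)
      1≤d (*-mono-≤ {1} {18} (s≤s z≤n) 1≤ℓ)
      (≤-<-trans (*-mono-≤ d+1≤n d+1≤n) (n*n<2^[18*ℓ] 1≤ℓ n<))
      C C-large n-large (λ v → ≤-trans d≤δ (δ≤degree G v)) _ refl))
    where
    open ≤-Reasoning
    2≤d+1 : 2 ≤ d + 1
    2≤d+1 = +-monoˡ-≤ 1 1≤d
    n-large : C * (d * (18 * ℓ * (18 * ℓ))) ≤ n
    n-large = ≤-trans (≤-reflexive (lemma C d ℓ)) (log²-bound (C * 324) {d} ℓ ≤n d-small)
      where
      lemma : ∀ C d ℓ → C * (d * (18 * ℓ * (18 * ℓ))) ≡ C * 324 * (d * (ℓ * ℓ))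
      lemma = solve-∀
    d+1≤n : d + 1 ≤ n
    d+1≤n = begin
      d + 1                              ≤⟨ +-monoʳ-≤ d 1≤d ⟩
      d + d                              ≡⟨ cong (_+_ d) (+-identityʳ d) ⟨
      2 * d                              ≡⟨ cong (2 *_) (*-identityʳ d) ⟨
      2 * (d * 1)                        ≤⟨ *-mono-≤ (≤-<-trans {1} {76160} (s≤s z≤n) C-large)
                                             (*-monoʳ-≤ d (*-mono-≤ 1≤18ℓ 1≤18ℓ)) ⟩
      C * (d * (18 * ℓ * (18 * ℓ)))      ≤⟨ n-large ⟩
      n                                  ∎
      where
      1≤18ℓ : 1 ≤ 18 * ℓ
      1≤18ℓ = *-mono-≤ {1} {18} (s≤s z≤n) 1≤ℓ

theorem1p3 : ∃[ c ] (0ℚ ℚ.< c × (∃[ n₀ ] (2 ≤ n₀ ×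
    (∀ (n d : ℕ) → n₀ ≤ n → 1 ≤ d → d ≤ c · n /log² n →
    ∀ (G : Graph n) → d ≤ Graph.δ G → d + 1 ≤ ψₛ G))))
-- 76161 is the least integer above the threshold 76160, and n₀ = 32 = 2 * 16 ensures ℓ ≥ 1.
theorem1p3 = 1ℤ ℚ./ (76161 * 324) , ℚ.positive⁻¹ _ {{ℚ.normalize-pos 1 (76161 * 324)}} ,
  32 , s≤s (s≤s z≤n) , d+1≤ψₛ 76161 ≤-refl
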